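{- For an integer $p\geq 2$, let $\Psi_p$ be the smallest number such that $\mathrm{id}^{\leq p}(G) \leq \left\lceil \frac{|E(G)|}{\lfloor p/2\rfloor}\right\rceil + \Psi_p$ for every graph $G$. Then (i) if $2\leq p\leq 5$, $\Psi_p = 0$; (ii) if $p\in\{6,7,8,9\}$, $\Psi_p = 1$.
   Context: All graphs are finite and simple. In an oriented graph, the inversion of a vertex set $X$ reverses the orientation of every arc with both endvertices in $X$; a $(\leq p)$-inversion is the inversion of a set of at most $p$ vertices. For a graph $G$ with labelled vertices, $\mathrm{id}^{\leq p}(G)$ is the maximum, over all pairs of orientations $\vec G_1,\vec G_2$ of $G$, of the minimum number of $(\leq p)$-inversions transforming $\vec G_1$ into $\vec G_2$. -}

module Defs where

open import Data.Nat using (ℕ; zero; suc; _+_; _≤_; _<_; ⌊_/2⌋)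
open import Data.Nat.DivMod using (_/_)
open import Data.Integer as ℤ using (ℤ; +_)
open import Data.Bool using (Bool; true; false; if_then_else_; _∧_; _xor_)
open import Data.Fin using (Fin; toℕ)
open import Data.Fin.Subset using (Subset; ∣_∣)
open import Data.Vec using (lookup)
open import Data.List using (List; []; _∷_; length; foldl; filter; concatMap; allFin; map)
open import Data.List.Relation.Unary.All using (All)
open import Data.Product using (Σ; _×_)
open import Relation.Binary.PropositionalEquality using (_≡_)
open import Data.Nat.Properties using (_<?_)

record Graph (n : ℕ) : Set where
  field
    adj    : Fin n → Fin n → Bool
    sym    : ∀ i j → adj i j ≡ adj j i
    irrefl : ∀ i → adj i i ≡ false
open Graph public

edgeCount : ∀ {n} → Graph n → ℕ
edgeCount {n} G =
  length (filter (λ ij → toℕ (Data.Product.proj₁ ij) <? toℕ (Data.Product.proj₂ ij))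
           (filter (λ ij → adj G (Data.Product.proj₁ ij) (Data.Product.proj₂ ij) Data.Bool.≟ true)
             (concatMap (λ i → map (λ j → i Data.Product., j) (allFin n)) (allFin n))))

Arcs : ℕ → Set
Arcs n = Fin n → Fin n → Bool

record Orientation {n : ℕ} (G : Graph n) : Set where
  field
    arc      : Arcs n
    oriented : ∀ i j → adj G i j ≡ true → (arc i j xor arc j i) ≡ true
    nonEdge  : ∀ i j → adj G i j ≡ false → arc i j ≡ false
open Orientation public

invert : ∀ {n} → Subset n → Arcs n → Arcs n
invert X a i j = if lookup X i ∧ lookup X j then a j i else a i j

invertAll : ∀ {n} → List (Subset n) → Arcs n → Arcs n
invertAll Xs a = foldl (λ b X → invert X b) a Xs

Transforms : ∀ {n} → ℕ → List (Subset n) → Arcs n → Arcs n → Set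
Transforms {n} p Xs a b =
  All (λ X → ∣ X ∣ ≤ p) Xs × (∀ i j → invertAll Xs a i j ≡ b i j)

-- id^{≤p}(G) ≤ t   (t an integer): for every pair of orientations, the minimum
-- number of (≤ p)-inversions transforming one into the other is at most t,
-- i.e. some transforming sequence has length ≤ t.
IdLe : ∀ {n} → ℕ → Graph n → ℤ → Set
IdLe {n} p G t =
  (D₁ D₂ : Orientation G) →
  Σ (List (Subset n)) λ Xs → Transforms p Xs (arc D₁) (arc D₂) × (+ length Xs) ℤ.≤ t

-- ⌈ m / k ⌉ for k ≥ 1 (value at k = 0 is irrelevant and set to 0).
ceilDiv : ℕ → ℕ → ℕ
ceilDiv m zero    = 0
ceilDiv m (suc k) = (m + k) / suc k

BoundHolds : ℕ → ℤ → Set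
BoundHolds p ψ = ∀ (n : ℕ) (G : Graph n) → IdLe p G (+ ceilDiv (edgeCount G) ⌊ p /2⌋ ℤ.+ ψ)

IsPsi : ℕ → ℤ → Set
IsPsi p ψ = BoundHolds p ψ × (∀ ψ' → BoundHolds p ψ' → ψ ℤ.≤ ψ')

{-# OPTIONS --safe #-}
module Submission where

-- Compare two orientations of G: an edge is to be flipped if they disagree on it.  Put q = ⌊p/2⌋.
-- Inverting v together with p − 1 of its flip-neighbours at a time settles all edges at v, after
-- which v can be deleted; if deg v ≥ q this costs at most one inversion per q deleted edges.  A
-- matching needs ⌈m/q⌉ inversions, which finishes q ≤ 2.  If Δ < q, two vertices u, v can be settled
-- by a single inversion of both flip-stars unless uv must be kept or some common neighbour w has
-- exactly one of uw, vw to be flipped; this is free if at least q edges disappear.  For Δ ≤ 2 such a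
-- pair exists as soon as there are three independent vertices of degree 2, and otherwise deleting
-- two vertices leaves a matching.  For q = 4 and Δ = 3 the absence of free pairs confines the graph
-- to the second neighbourhood of a cubic vertex, and a finite search leaves at most 7 or exactly 9
-- edges, for which repeated deletion of vertices of degree ≥ 2 is good enough.  The additive
-- constant 1 is needed for the triangle with two edges to be flipped.

open import Defs
open import Data.Bool using (Bool; true; false; not; _∧_; _∨_; _xor_; if_then_else_) renaming (_≟_ to _≟ᵇ_)
open import Data.Bool.Properties using (∧-comm; ∨-comm)
open import Data.Empty using (⊥)
open import Data.Fin using (Fin; zero; suc; toℕ; opposite; _≟_)
open import Data.Fin.Patterns using (0F; 1F; 2F)
open import Data.Fin.Properties using (any?; opposite-involutive; toℕ-injective; suc-injective)
open import Data.Fin.Subset using (∣_∣)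
import Data.Integer as ℤ
open import Data.List as List using (List; []; _∷_; _++_; length; map; filter; concatMap; allFin)
open import Data.List.Properties using (length-map; filter-++; length-++)
open import Data.List.Relation.Unary.All using (All; []; _∷_)
open import Data.Nat using (ℕ; zero; suc; _+_; _*_; _≤_; _<_; z≤n; s≤s; ⌊_/2⌋)
open import Data.Nat.Divisibility using (n∣m*n)
open import Data.Nat.DivMod using (_/_; m*n/n≡m; /-monoˡ-≤; +-distrib-/-∣ʳ)
open import Data.Nat.Induction using (<-wellFounded)
open import Data.Nat.Properties as ℕₚ hiding (_≟_; suc-injective)
open import Data.Nat.Tactic.RingSolver using (solve-∀)
open import Data.Product using (∃; _×_; _,_; proj₁; proj₂)
open import Data.Sum using (_⊎_; inj₁; inj₂; [_,_]′)
open import Data.Unit using (⊤; tt)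
open import Data.Vec using (Vec; []; _∷_; lookup; tabulate)
open import Data.Vec.Properties using (lookup∘tabulate)
open import Function using (_∘_; id; case_of_)
open import Function.Definitions using (Injective)
import Induction.WellFounded as WF
open import Relation.Binary.Construct.On using (wellFounded)
open import Relation.Binary.Definitions using (Tri; tri<; tri≈; tri>)
open import Relation.Binary.PropositionalEquality as ≡ using (_≡_; _≢_; refl; trans; cong; cong₂; subst; subst₂)
open import Relation.Nullary using (Dec; yes; no; ¬_; does; contradiction)
open import Relation.Nullary.Decidable using (dec-true; dec-false; ¬?; _×-dec_; _⊎-dec_; _→-dec_; toWitness)
open import Algebra.Properties.CommutativeMonoid.Sum +-0-commutativeMonoid using (sum; sum-cong-≗; ∑-distrib-+; ∑-comm)

private
  variable
    n k : ℕ

-- Finite sums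

sum-mono-≤ : {f g : Fin n → ℕ} → (∀ i → f i ≤ g i) → sum f ≤ sum g
sum-mono-≤ {n = zero}  f≤g = z≤n
sum-mono-≤ {n = suc n} f≤g = +-mono-≤ (f≤g zero) (sum-mono-≤ (f≤g ∘ suc))

sum-zero : {f : Fin n → ℕ} → (∀ i → f i ≡ 0) → sum f ≡ 0
sum-zero {n = zero}  f≡0 = refl
sum-zero {n = suc n} f≡0 = cong₂ _+_ (f≡0 zero) (sum-zero (f≡0 ∘ suc))

infixl 8 _without_

_without_ : (Fin n → ℕ) → Fin n → Fin n → ℕ
(f without a) i = if does (i ≟ a) then 0 else f i

without-hit : (f : Fin n → ℕ) (a : Fin n) → (f without a) a ≡ 0
without-hit f a rewrite dec-true (a ≟ a) refl = refl

without-miss : (f : Fin n → ℕ) {a i : Fin n} → i ≢ a → (f without a) i ≡ f i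
without-miss f {a} {i} i≢a rewrite dec-false (i ≟ a) i≢a = refl

without-≤ : (f : Fin n → ℕ) (a i : Fin n) → (f without a) i ≤ f i
without-≤ f a i with does (i ≟ a)
... | true  = z≤n
... | false = ≤-refl

sum-without : (f : Fin n → ℕ) (a : Fin n) → sum f ≡ f a + sum (f without a)
sum-without f zero    = refl
sum-without f (suc a) = begin
  f zero + sum (f ∘ suc)                           ≡⟨ cong (f zero +_) (sum-without (f ∘ suc) a) ⟩
  f zero + (f (suc a) + sum ((f ∘ suc) without a)) ≡⟨ swap (f zero) (f (suc a)) _ ⟩
  f (suc a) + (f zero + sum ((f ∘ suc) without a)) ∎
  where
  open ≡.≡-Reasoning
  swap : ∀ x y z → x + (y + z) ≡ y + (x + z)
  swap = solve-∀

sum-injective-≤ : (f : Fin n → ℕ) (x : Fin k → Fin n) → Injective _≡_ _≡_ x → sum (f ∘ x) ≤ sum f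
sum-injective-≤ {k = zero}  f x inj = z≤n
sum-injective-≤ {k = suc k} f x inj = begin
  f (x zero) + sum (f ∘ x ∘ suc)
    ≡⟨ cong (f (x zero) +_) (sum-cong-≗ λ i → without-miss f {x zero} {x (suc i)} λ e → contradiction (inj e) λ ()) ⟨
  f (x zero) + sum ((f without x zero) ∘ x ∘ suc)
    ≤⟨ +-monoʳ-≤ _ (sum-injective-≤ (f without x zero) (x ∘ suc) λ e → suc-injective (inj e)) ⟩
  f (x zero) + sum (f without x zero)
    ≡⟨ sum-without f (x zero) ⟨
  sum f ∎
  where
  open ≤-Reasoning

-- The value at `x zero` is set to zero before recursing, so later repetitions of the same vertex
-- cannot spoil the cover, and `x` may fail to be injective.
sum-cover-≤ : (f : Fin n → ℕ) (x : Fin k → Fin n) →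
              (∀ y → f y ≡ 0 ⊎ ∃ λ i → x i ≡ y) → sum f ≤ sum (f ∘ x)
sum-cover-≤ {k = zero} f x cover = ≤-reflexive (sum-zero λ y → [ id , (λ ()) ]′ (cover y))
sum-cover-≤ {k = suc k} f x cover = begin
  sum f                                     ≡⟨ sum-without f (x zero) ⟩
  f (x zero) + sum (f without x zero)       ≤⟨ +-monoʳ-≤ _ (sum-cover-≤ (f without x zero) (x ∘ suc) cover′) ⟩
  f (x zero) + sum ((f without x zero) ∘ x ∘ suc)
    ≤⟨ +-monoʳ-≤ _ (sum-mono-≤ λ i → without-≤ f (x zero) (x (suc i))) ⟩
  f (x zero) + sum (f ∘ x ∘ suc) ∎
  where
  open ≤-Reasoning
  cover′ : ∀ y → (f without x zero) y ≡ 0 ⊎ ∃ λ i → x (suc i) ≡ y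
  cover′ y with cover y
  ... | inj₁ fy≡0           = inj₁ (n≤0⇒n≡0 (subst ((f without x zero) y ≤_) fy≡0 (without-≤ f (x zero) y)))
  ... | inj₂ (zero , refl)  = inj₁ (without-hit f (x zero))
  ... | inj₂ (suc i , xi≡y) = inj₂ (i , xi≡y)

term-≤ : (f : Fin n → ℕ) (a : Fin n) → f a ≤ sum f
term-≤ f a = subst (f a ≤_) (≡.sym (sum-without f a)) (m≤m+n _ _)

two-terms-≤ : (f : Fin n → ℕ) {a b : Fin n} → a ≢ b → f a + f b ≤ sum f
two-terms-≤ f {a} {b} a≢b = begin
  f a + f b                 ≡⟨ cong (f a +_) (without-miss f (a≢b ∘ ≡.sym)) ⟨
  f a + (f without a) b     ≤⟨ +-monoʳ-≤ (f a) (term-≤ (f without a) b) ⟩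
  f a + sum (f without a)   ≡⟨ sum-without f a ⟨
  sum f                     ∎
  where open ≤-Reasoning

three-terms-≤ : (f : Fin n → ℕ) {a b c : Fin n} → a ≢ b → a ≢ c → b ≢ c → f a + (f b + f c) ≤ sum f
three-terms-≤ f {a} {b} {c} a≢b a≢c b≢c = begin
  f a + (f b + f c)
    ≡⟨ cong (f a +_) (cong₂ _+_ (without-miss f (a≢b ∘ ≡.sym)) (without-miss f (a≢c ∘ ≡.sym))) ⟨
  f a + ((f without a) b + (f without a) c)  ≤⟨ +-monoʳ-≤ (f a) (two-terms-≤ (f without a) b≢c) ⟩
  f a + sum (f without a)                    ≡⟨ sum-without f a ⟨
  sum f                                      ∎
  where open ≤-Reasoning

bit : Bool → ℕ
bit false = 0
bit true  = 1

card : (Fin n → Bool) → ℕ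
card X = sum (bit ∘ X)

bit-∨ : ∀ a b → bit (a ∨ b) ≤ bit a + bit b
bit-∨ false b = ≤-refl
bit-∨ true  b = s≤s z≤n

card-∨ : (X Y : Fin n → Bool) → card (λ i → X i ∨ Y i) ≤ card X + card Y
card-∨ X Y = ≤-trans (sum-mono-≤ λ i → bit-∨ (X i) (Y i)) (≤-reflexive (∑-distrib-+ (bit ∘ X) (bit ∘ Y)))

single : Fin n → Fin n → Bool
single a i = does (i ≟ a)

single-refl : (a : Fin n) → single a a ≡ true
single-refl a = dec-true (a ≟ a) refl

card-single : (a : Fin n) → card (single a) ≡ 1
card-single a = trans (sum-without (bit ∘ single a) a)
  (cong₂ _+_ (cong bit (single-refl a)) (sum-zero off))
  where
  off : ∀ i → (bit ∘ single a without a) i ≡ 0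
  off i with does (i ≟ a)
  ... | true  = refl
  ... | false = refl

pick : (X : Fin n → Bool) (s : ℕ) → s ≤ card X →
       ∃ λ Y → card Y ≡ s × (∀ i → Y i ≡ true → X i ≡ true)
pick {n = zero}  X zero s≤ = X , refl , λ ()
pick {n = suc n} X zero s≤ = (λ _ → false) , sum-zero {n = suc n} (λ _ → refl) , λ _ ()
pick {n = suc n} X (suc s) s≤ with X zero in eq
... | false with pick (X ∘ suc) (suc s) s≤
...   | Y , card≡ , Y⊆X = Y′ , card≡ , sub
  where
  Y′ : Fin (suc n) → Bool
  Y′ zero    = false
  Y′ (suc i) = Y i
  sub : ∀ i → Y′ i ≡ true → X i ≡ true
  sub zero    ()
  sub (suc i) = Y⊆X i
pick {n = suc n} X (suc s) (s≤s s≤) | true with pick (X ∘ suc) s s≤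
...   | Y , card≡ , Y⊆X = Y′ , cong suc card≡ , sub
  where
  Y′ : Fin (suc n) → Bool
  Y′ zero    = true
  Y′ (suc i) = Y i
  sub : ∀ i → Y′ i ≡ true → X i ≡ true
  sub zero    _ = eq
  sub (suc i) = Y⊆X i

-- Markings

-- A non-edge, an edge on which the two orientations agree, and one on which they differ.
data Colour : Set where
  none keep flip : Colour

size : Colour → ℕ
size none = 0
size keep = 1
size flip = 1

isFlip : Colour → Bool
isFlip none = false
isFlip keep = false
isFlip flip = true

toggle : Bool → Colour → Colour
toggle false c    = c
toggle true  none = none
toggle true  keep = flip
toggle true  flip = keep

size-toggle : ∀ b c → size (toggle b c) ≡ size c
size-toggle false c    = refl
size-toggle true  none = refl
size-toggle true  keep = refl
size-toggle true  flip = refl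

toggle-none : ∀ b → toggle b none ≡ none
toggle-none false = refl
toggle-none true  = refl

toggle-xor : ∀ a b c → toggle (a xor b) c ≡ toggle b (toggle a c)
toggle-xor false b     c    = refl
toggle-xor true  false c    = refl
toggle-xor true  true  none = refl
toggle-xor true  true  keep = refl
toggle-xor true  true  flip = refl

size≡0⇒none : ∀ {c} → size c ≡ 0 → c ≡ none
size≡0⇒none {none} _ = refl

isFlip-size : ∀ c → bit (isFlip c) ≤ size c
isFlip-size none = z≤n
isFlip-size keep = z≤n
isFlip-size flip = ≤-refl

isFlip⇒flip : ∀ {c} → isFlip c ≡ true → c ≡ flip
isFlip⇒flip {flip} _ = refl

record Marking (n : ℕ) : Set where
  field
    colour     : Fin n → Fin n → Colour
    symmetric  : ∀ i j → colour i j ≡ colour j i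
    loopless   : ∀ i → colour i i ≡ none

  deg : Fin n → ℕ
  deg i = sum λ j → size (colour i j)

  flips : Fin n → ℕ
  flips i = card λ j → isFlip (colour i j)

  total : ℕ
  total = sum deg
open Marking public

flips≤deg : (L : Marking n) → ∀ i → flips L i ≤ deg L i
flips≤deg L i = sum-mono-≤ λ j → isFlip-size (colour L i j)

reverse : (Fin n → Bool) → Marking n → Marking n
reverse X L = record
  { colour    = λ i j → toggle (X i ∧ X j) (colour L i j)
  ; symmetric = λ i j → cong₂ toggle (∧-comm (X i) (X j)) (symmetric L i j)
  ; loopless  = λ i → trans (cong (toggle (X i ∧ X i)) (loopless L i)) (toggle-none _)
  }

-- The vertex stays in the index type and becomes isolated, which avoids renumbering.
delete : Fin n → Marking n → Marking n
delete v L = record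
  { colour    = c
  ; symmetric = s
  ; loopless  = l
  }
  where
  c : Fin _ → Fin _ → Colour
  c i j = if single v i ∨ single v j then none else colour L i j
  s : ∀ i j → c i j ≡ c j i
  s i j rewrite ∨-comm (single v i) (single v j) | symmetric L i j = refl
  l : ∀ i → c i i ≡ none
  l i with single v i ∨ single v i
  ... | true  = refl
  ... | false = loopless L i

delete-hitˡ : (L : Marking n) (v j : Fin n) → colour (delete v L) v j ≡ none
delete-hitˡ L v j rewrite single-refl v = refl

delete-hitʳ : (L : Marking n) (v j : Fin n) → colour (delete v L) j v ≡ none
delete-hitʳ L v j = trans (symmetric (delete v L) j v) (delete-hitˡ L v j)

delete-miss : (L : Marking n) {v i j : Fin n} → i ≢ v → j ≢ v → colour (delete v L) i j ≡ colour L i j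
delete-miss L {v} {i} {j} i≢v j≢v rewrite dec-false (i ≟ v) i≢v | dec-false (j ≟ v) j≢v = refl

delete-≤ : (L : Marking n) (v i j : Fin n) → size (colour (delete v L) i j) ≤ size (colour L i j)
delete-≤ L v i j with single v i ∨ single v j
... | true  = z≤n
... | false = ≤-refl

infix 4 _≈_

-- Equality of the underlying graphs. Inversions preserve it, so degrees and edge counts can be
-- computed before or after them.
_≈_ : Marking n → Marking n → Set
L ≈ M = ∀ i j → size (colour L i j) ≡ size (colour M i j)

≈-trans : {L M N : Marking n} → L ≈ M → M ≈ N → L ≈ N
≈-trans L≈M M≈N i j = trans (L≈M i j) (M≈N i j)

≈-deg : (L M : Marking n) → L ≈ M → ∀ i → deg L i ≡ deg M i
≈-deg L M L≈M i = sum-cong-≗ (L≈M i)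

≈-total : (L M : Marking n) → L ≈ M → total L ≡ total M
≈-total L M L≈M = sum-cong-≗ (≈-deg L M L≈M)

≈-reverse : (X : Fin n → Bool) (L : Marking n) → reverse X L ≈ L
≈-reverse X L i j = size-toggle (X i ∧ X j) (colour L i j)

≈-delete : (v : Fin n) (L M : Marking n) → L ≈ M → delete v L ≈ delete v M
≈-delete v L M L≈M i j with single v i ∨ single v j
... | true  = refl
... | false = L≈M i j

deg-delete : (L : Marking n) {v i : Fin n} → i ≢ v → deg L i ≡ size (colour L i v) + deg (delete v L) i
deg-delete L {v} {i} i≢v = trans (sum-without (size ∘ colour L i) v) (cong (_ +_) (sum-cong-≗ same))
  where
  same : ∀ j → (size ∘ colour L i without v) j ≡ size (colour (delete v L) i j)
  same j = case j ≟ v of λ where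
    (yes refl) → trans (without-hit (size ∘ colour L i) v) (≡.sym (cong size (delete-hitʳ L v i)))
    (no j≢v)   → trans (without-miss (size ∘ colour L i) j≢v) (≡.sym (cong size (delete-miss L i≢v j≢v)))

deg-delete-≤ : (L : Marking n) (v i : Fin n) → deg (delete v L) i ≤ deg L i
deg-delete-≤ L v i = sum-mono-≤ (delete-≤ L v i)

-- Each edge at `v` is counted once in the degree of `v` and once in that of its other end.
total-delete : (L : Marking n) (v : Fin n) → total L ≡ (deg L v + deg L v) + total (delete v L)
total-delete L v = begin
  total L                                                    ≡⟨ sum-without (deg L) v ⟩
  deg L v + sum (deg L without v)                            ≡⟨ cong (deg L v +_) (sum-cong-≗ split) ⟩
  deg L v + sum (λ i → size (colour L i v) + deg (delete v L) i)
    ≡⟨ cong (deg L v +_) (∑-distrib-+ (λ i → size (colour L i v)) (deg (delete v L))) ⟩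
  deg L v + (sum (λ i → size (colour L i v)) + total (delete v L))
    ≡⟨ cong (λ d → deg L v + (d + total (delete v L))) (sum-cong-≗ λ i → cong size (symmetric L i v)) ⟩
  deg L v + (deg L v + total (delete v L))                   ≡⟨ +-assoc (deg L v) _ _ ⟨
  (deg L v + deg L v) + total (delete v L)                   ∎
  where
  open ≡.≡-Reasoning
  split : ∀ i → (deg L without v) i ≡ size (colour L i v) + deg (delete v L) i
  split i = case i ≟ v of λ where
    (yes refl) → trans (without-hit (deg L) v)
      (≡.sym (cong₂ _+_ (cong size (loopless L v)) (sum-zero λ j → cong size (delete-hitˡ L v j))))
    (no i≢v)   → trans (without-miss (deg L) i≢v) (deg-delete L i≢v)

-- Solutions

parity : List (Fin n → Bool) → Fin n → Fin n → Bool
parity []       i j = false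
parity (X ∷ Xs) i j = (X i ∧ X j) xor parity Xs i j

-- For p = 2q, total L = 2m and bound = total L + c p, short says length sets ≤ ⌈m/q⌉ + c − 1.
record Solved (p bound : ℕ) (L : Marking n) : Set where
  field
    sets    : List (Fin n → Bool)
    bounded : All (λ X → card X ≤ p) sets
    fixes   : ∀ i j → toggle (parity sets i j) (colour L i j) ≢ flip
    short   : p * length sets < bound
open Solved public

module _ {p : ℕ} where

  solved-trivial : {L : Marking n} {b : ℕ} → (∀ i j → colour L i j ≢ flip) → 0 < b → Solved p b L
  solved-trivial {b = b} clean 0<b = record
    { sets = [] ; bounded = [] ; fixes = clean ; short = subst (_< b) (≡.sym (*-zeroʳ p)) 0<b }

  solved-mono : {L : Marking n} {b c : ℕ} → b ≤ c → Solved p b L → Solved p c L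
  solved-mono b≤c S = record
    { sets = sets S ; bounded = bounded S ; fixes = fixes S ; short = <-≤-trans (short S) b≤c }

  solved-reverse : (X : Fin n → Bool) {L : Marking n} {b : ℕ} → card X ≤ p →
                   Solved p b (reverse X L) → Solved p (p + b) L
  solved-reverse X {L} {b} X≤p S = record
    { sets    = X ∷ sets S
    ; bounded = X≤p ∷ bounded S
    ; fixes   = λ i j e → fixes S i j (trans (≡.sym (toggle-xor (X i ∧ X j) _ (colour L i j))) e)
    ; short   = subst (_< p + b) (≡.sym (*-suc p _)) (+-monoʳ-< p (short S))
    }

  -- Later sets may be taken to avoid a deleted vertex, so its edges stay as they are.
  solved-delete : {L : Marking n} {v : Fin n} {b : ℕ} → (∀ j → colour L v j ≢ flip) →
                  Solved p b (delete v L) → Solved p b L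
  solved-delete {n} {L} {v} {b} clean S = record
    { sets    = map avoid (sets S)
    ; bounded = bounded′ (bounded S)
    ; fixes   = fixes′
    ; short   = subst (λ l → p * l < b) (≡.sym (length-map avoid (sets S))) (short S)
    }
    where
    avoid : (Fin n → Bool) → Fin n → Bool
    avoid X i = not (single v i) ∧ X i
    card-avoid : ∀ X → card (avoid X) ≤ card X
    card-avoid X = sum-mono-≤ λ i → le (not (single v i)) (X i)
      where
      le : ∀ a b → bit (a ∧ b) ≤ bit b
      le false b = z≤n
      le true  b = ≤-refl
    bounded′ : ∀ {Xs} → All (λ X → card X ≤ p) Xs → All (λ X → card X ≤ p) (map avoid Xs)
    bounded′ []               = []
    bounded′ {X ∷ _} (x ∷ xs) = ≤-trans (card-avoid X) x ∷ bounded′ xs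
    parity-avoid : ∀ Xs i j → parity (map avoid Xs) i j ≡ (if single v i ∨ single v j then false else parity Xs i j)
    parity-avoid [] i j with single v i ∨ single v j
    ... | true  = refl
    ... | false = refl
    parity-avoid (X ∷ Xs) i j rewrite parity-avoid Xs i j with single v i | single v j
    ... | true  | _     = refl
    ... | false | false = refl
    ... | false | true  with X i
    ...   | true  = refl
    ...   | false = refl
    fixes′ : ∀ i j → toggle (parity (map avoid (sets S)) i j) (colour L i j) ≢ flip
    fixes′ i j with i ≟ v | j ≟ v | parity-avoid (sets S) i j | fixes S i j
    ... | yes refl | _        | e | _ rewrite e = clean j
    ... | no _     | yes refl | e | _ rewrite e | symmetric L i j = clean i
    ... | no _     | no _     | e | f rewrite e = f

reverse-clean : (L : Marking n) (X : Fin n → Bool) {u : Fin n} → X u ≡ true →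
                (∀ j → colour L u j ≡ flip → X j ≡ true) → (∀ j → colour L u j ≡ keep → X j ≡ false) →
                ∀ j → colour (reverse X L) u j ≢ flip
reverse-clean L X {u} Xu onFlip onKeep j with colour L u j | onFlip j | onKeep j
... | none | _  | _  rewrite toggle-none (X u ∧ X j) = λ ()
... | keep | _  | ok rewrite Xu | ok refl = λ ()
... | flip | of | _  rewrite Xu | of refl = λ ()

-- Pairs of vertices settled by one inversion

Clash : Colour → Colour → Set
Clash keep flip = ⊤
Clash flip keep = ⊤
Clash _    _    = ⊥

clash? : ∀ c d → Dec (Clash c d)
clash? none _    = no λ ()
clash? keep none = no λ ()
clash? keep keep = no λ ()
clash? keep flip = yes tt
clash? flip none = no λ ()
clash? flip keep = yes tt
clash? flip flip = no λ ()

keep-flip-clash : ∀ {c d} → c ≡ keep → d ≡ flip → Clash c d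
keep-flip-clash refl refl = tt

clash-sym : ∀ {c d} → Clash c d → Clash d c
clash-sym {keep} {flip} _ = tt
clash-sym {flip} {keep} _ = tt

clash⇒edges : ∀ {c d} → Clash c d → size c ≡ 1 × size d ≡ 1
clash⇒edges {keep} {flip} _ = refl , refl
clash⇒edges {flip} {keep} _ = refl , refl

keep? : ∀ c → Dec (c ≡ keep)
keep? none = no λ ()
keep? keep = yes refl
keep? flip = no λ ()

-- Stated for a bare colour function so that it applies to a `Pattern` too. In a marking `w` may
-- also be `u` or `v`, because loops are `none` and clash with nothing.
Compatible : (Fin n → Fin n → Colour) → Fin n → Fin n → Set
Compatible c u v = c u v ≢ keep × ¬ (∃ λ w → Clash (c u w) (c v w))

compatible? : (c : Fin n → Fin n → Colour) (u v : Fin n) → Dec (Compatible c u v)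
compatible? c u v = ¬? (keep? (c u v)) ×-dec ¬? (any? λ w → clash? (c u w) (c v w))

compatible-sym : (L : Marking n) {u v : Fin n} → Compatible (colour L) u v → Compatible (colour L) v u
compatible-sym L {u} {v} (≢keep , noClash) =
  (λ e → ≢keep (trans (symmetric L u v) e)) , λ (w , cl) → noClash (w , clash-sym {colour L v w} cl)

∨-true : ∀ {a b} → a ∨ b ≡ true → a ≡ true ⊎ b ≡ true
∨-true {true}  _ = inj₁ refl
∨-true {false} e = inj₂ e

∨-introˡ : ∀ {a b} → a ≡ true → a ∨ b ≡ true
∨-introˡ refl = refl

∨-introʳ : ∀ {a b} → b ≡ true → a ∨ b ≡ true
∨-introʳ {true}  refl = refl
∨-introʳ {false} refl = refl

≢true⇒false : ∀ {a} → a ≢ true → a ≡ false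
≢true⇒false {false} _  = refl
≢true⇒false {true}  ≢t = contradiction refl ≢t

single⇒≡ : {a i : Fin n} → single a i ≡ true → i ≡ a
single⇒≡ {a = a} {i} e with i ≟ a
single⇒≡ e  | yes i≡a = i≡a
single⇒≡ () | no _

module _ (L : Marking n) (u v : Fin n) where

  doubleStar : Fin n → Bool
  doubleStar i = (single u i ∨ single v i) ∨ (isFlip (colour L u i) ∨ isFlip (colour L v i))

  card-doubleStar : card doubleStar ≤ 2 + (flips L u + flips L v)
  card-doubleStar = begin
    card doubleStar
      ≤⟨ card-∨ (λ i → single u i ∨ single v i) _ ⟩
    card (λ i → single u i ∨ single v i) + card (λ i → isFlip (colour L u i) ∨ isFlip (colour L v i))
      ≤⟨ +-mono-≤ (card-∨ (single u) (single v)) (card-∨ (isFlip ∘ colour L u) (isFlip ∘ colour L v)) ⟩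
    (card (single u) + card (single v)) + (flips L u + flips L v)
      ≡⟨ cong (_+ (flips L u + flips L v)) (cong₂ _+_ (card-single u) (card-single v)) ⟩
    2 + (flips L u + flips L v) ∎
    where open ≤-Reasoning

  -- A `keep`-neighbour of `u` could enter the set only as `v` itself or as a flip-neighbour of `v`;
  -- the two halves of `Compatible` exclude this.
  separated : Compatible (colour L) u v → ∀ j → colour L u j ≡ keep → doubleStar j ≡ false
  separated (≢keep , noClash) j uj≡keep = ≢true⇒false λ e → case ∨-true e of λ where
    (inj₁ e′) → case ∨-true {single u j} e′ of λ where
      (inj₁ j≡u) → case trans (≡.sym (loopless L u)) (subst (λ i → colour L u i ≡ keep) (single⇒≡ j≡u) uj≡keep) of λ ()
      (inj₂ j≡v) → ≢keep (subst (λ i → colour L u i ≡ keep) (single⇒≡ j≡v) uj≡keep)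
    (inj₂ e′) → case ∨-true {isFlip (colour L u j)} e′ of λ where
      (inj₁ uj≡flip) → case trans (≡.sym uj≡keep) (isFlip⇒flip uj≡flip) of λ ()
      (inj₂ vj≡flip) → noClash (j , keep-flip-clash uj≡keep (isFlip⇒flip vj≡flip))

  removePair : Marking n
  removePair = delete v (delete u (reverse doubleStar L))

  -- A possible edge between `u` and `v` occurs in both degrees although it is deleted once. The
  -- surplus is added on the left to avoid subtraction.
  total-removePair : u ≢ v →
    total L + (size (colour L v u) + size (colour L v u)) ≡ ((deg L u + deg L v) + (deg L u + deg L v)) + total removePair
  total-removePair u≢v = begin
    total L + (a + a)                        ≡⟨ cong (_+ (a + a)) (total-delete L u) ⟩
    ((deg L u + deg L u) + total Lu) + (a + a)
      ≡⟨ cong (λ t → ((deg L u + deg L u) + t) + (a + a)) (total-delete Lu v) ⟩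
    ((deg L u + deg L u) + ((deg Lu v + deg Lu v) + total (delete v Lu))) + (a + a)
      ≡⟨ shuffle (deg L u) (deg Lu v) _ a ⟩
    ((deg L u + (a + deg Lu v)) + (deg L u + (a + deg Lu v))) + total (delete v Lu)
      ≡⟨ cong₂ (λ d t → ((deg L u + d) + (deg L u + d)) + t) (deg-delete L (u≢v ∘ ≡.sym)) same ⟨
    ((deg L u + deg L v) + (deg L u + deg L v)) + total removePair ∎
    where
    open ≡.≡-Reasoning
    a = size (colour L v u)
    Lu = delete u L
    same : total removePair ≡ total (delete v Lu)
    same = ≈-total removePair (delete v Lu)
      (≈-delete v (delete u (reverse doubleStar L)) Lu (≈-delete u (reverse doubleStar L) L (≈-reverse doubleStar L)))
    shuffle : ∀ x y t a → ((x + x) + ((y + y) + t)) + (a + a) ≡ ((x + (a + y)) + (x + (a + y))) + t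
    shuffle = solve-∀

-- All edges at u and v are settled by one inversion of the union of their flip-stars:
-- compatibility says that no unwanted edge at u or v gets reversed.
solved-pair : {p b : ℕ} (L : Marking n) (u v : Fin n) → Compatible (colour L) u v →
              2 + (flips L u + flips L v) ≤ p → Solved p b (removePair L u v) → Solved p (p + b) L
solved-pair L u v comp small S =
  solved-reverse X (≤-trans (card-doubleStar L u v) small) (solved-delete cleanU (solved-delete cleanV S))
  where
  X = doubleStar L u v
  swap : ∀ {a b c d} → (a ∨ b) ∨ (c ∨ d) ≡ false → (b ∨ a) ∨ (d ∨ c) ≡ false
  swap {false} {false} {false} {false} _ = refl
  cleanU : ∀ j → colour (reverse X L) u j ≢ flip
  cleanU = reverse-clean L X (∨-introˡ (∨-introˡ (single-refl u)))
    (λ j e → ∨-introʳ {single u j ∨ single v j} (∨-introˡ (cong isFlip e))) (separated L u v comp)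
  cleanV₀ : ∀ j → colour (reverse X L) v j ≢ flip
  cleanV₀ = reverse-clean L X (∨-introˡ (∨-introʳ {single u v} (single-refl v)))
    (λ j e → ∨-introʳ {single u j ∨ single v j} (∨-introʳ {isFlip (colour L u j)} (cong isFlip e)))
    (λ j e → swap {single v j} {single u j} {isFlip (colour L v j)} (separated L v u (compatible-sym L comp) j e))
  cleanV : ∀ j → colour (delete u (reverse X L)) v j ≢ flip
  cleanV j with single u v ∨ single u j
  ... | true  = λ ()
  ... | false = cleanV₀ j

-- Inversions of sets of at most p = 2q vertices, where q = r + 1
module _ (r : ℕ) where

  private
    q = suc r
    -- This is p - 1, the number of neighbours that fit into a set beside its centre.
    s = r + q
    p = q + q

  -- The field `few` expresses without division that `count` is at most the ceiling of `flips L v`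
  -- over `s`.
  record Cleared (L : Marking n) (v : Fin n) : Set where
    field
      count   : ℕ
      result  : Marking n
      few     : count * s < flips L v + s
      similar : result ≈ L
      clean   : ∀ j → colour result v j ≢ flip
      solve   : ∀ {b} → Solved p b result → Solved p (p * count + b) L
  open Cleared

  clear : (L : Marking n) (v : Fin n) → Cleared L v
  clear L v = go (flips L v) L ≤-refl
    where
    0<s : 0 < s
    0<s = subst (0 <_) (≡.sym (+-suc r r)) (s≤s z≤n)

    -- Among the edges at `v`, reversing `v` together with `Y` affects just those to `Y`, and all of
    -- these turn from `flip` to `keep`.
    part : (L : Marking _) (Y : Fin _ → Bool) → (∀ i → Y i ≡ true → isFlip (colour L v i) ≡ true) →
           flips L v ≡ card Y + flips (reverse (λ i → single v i ∨ Y i) L) v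
    part L Y Y⊆ = trans (sum-cong-≗ pt) (∑-distrib-+ (bit ∘ Y) _)
      where
      X = λ i → single v i ∨ Y i
      eq : ∀ c b → (b ≡ true → isFlip c ≡ true) → bit (isFlip c) ≡ bit b + bit (isFlip (toggle b c))
      eq none false _ = refl
      eq keep false _ = refl
      eq flip false _ = refl
      eq flip true  _ = refl
      eq none true  h = case h refl of λ ()
      eq keep true  h = case h refl of λ ()
      atV : ∀ b → (b ≡ true → isFlip (colour L v v) ≡ true) →
            bit (isFlip (colour L v v)) ≡ bit b + bit (isFlip (toggle (X v ∧ X v) (colour L v v)))
      atV b h rewrite loopless L v | toggle-none (X v ∧ X v) with b
      ... | false = refl
      ... | true  = case h refl of λ ()
      X-off : ∀ {j} → j ≢ v → X v ∧ X j ≡ Y j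
      X-off {j} j≢v rewrite single-refl v | dec-false (j ≟ v) j≢v = refl
      pt : ∀ j → bit (isFlip (colour L v j)) ≡ bit (Y j) + bit (isFlip (toggle (X v ∧ X j) (colour L v j)))
      pt j = case j ≟ v of λ where
        (yes refl) → atV (Y v) (Y⊆ v)
        (no j≢v)   → trans (eq (colour L v j) (Y j) (Y⊆ j))
          (cong (λ b → bit (Y j) + bit (isFlip (toggle b (colour L v j)))) (≡.sym (X-off j≢v)))

    step : (L : Marking _) (Y : Fin _ → Bool) → card Y ≤ s → ∀ {b} →
           Solved p b (reverse (λ i → single v i ∨ Y i) L) → Solved p (p + b) L
    step L Y Y≤s = solved-reverse _ (≤-trans (card-∨ (single v) Y)
      (≤-trans (≤-reflexive (cong (_+ card Y) (card-single v))) (s≤s Y≤s)))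

    noFlips : (L : Marking _) → flips L v ≡ 0 → ∀ j → colour L v j ≢ flip
    noFlips L f≡0 j e = <-irrefl (≡.sym f≡0)
      (≤-trans (≤-reflexive (cong (bit ∘ isFlip) (≡.sym e))) (term-≤ (bit ∘ isFlip ∘ colour L v) j))

    go : (m : ℕ) (L : Marking _) → flips L v ≤ m → Cleared L v
    go m L f≤m with flips L v ≤? 0
    ... | yes f≤0 = record
      { count = 0 ; result = L ; few = <-≤-trans 0<s (m≤n+m s (flips L v)) ; similar = λ _ _ → refl
      ; clean = noFlips L (n≤0⇒n≡0 f≤0) ; solve = solved-mono (m≤n+m _ (p * 0)) }
    ... | no f≰0 with flips L v ≤? s
    ...   | yes f≤s = record
      { count = 1 ; result = reverse X L
      ; few = ≤-trans (≤-reflexive (cong suc (*-identityˡ s))) (+-monoˡ-≤ s (≰⇒> f≰0))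
      ; similar = ≈-reverse X L
      ; clean = noFlips (reverse X L) (+-cancelˡ-≡ (flips L v) _ _
          (trans (≡.sym (part L (isFlip ∘ colour L v) (λ _ → id))) (≡.sym (+-identityʳ _))))
      ; solve = λ {b} S → solved-mono (≤-reflexive (cong (_+ b) (≡.sym (*-identityʳ p)))) (step L (isFlip ∘ colour L v) f≤s S)
      }
      where X = λ i → single v i ∨ isFlip (colour L v i)
    go zero L f≤m | no f≰0 | no f≰s = contradiction f≤m f≰0
    -- More than `s` flip-neighbours remain, so a full batch of exactly `s` is taken and both sides
    -- of `few` grow by `s`.
    go (suc m) L f≤m | no f≰0 | no f≰s with pick (isFlip ∘ colour L v) s (<⇒≤ (≰⇒> f≰s))
    ... | Y , cardY , Y⊆ = record
      { count = suc (count rest) ; result = result rest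
      ; few = few′
      ; similar = ≈-trans {L = result rest} {M = L′} {N = L} (similar rest) (≈-reverse X L)
      ; clean = clean rest
      ; solve = λ {b} S → solved-mono (≤-reflexive (regroup p (count rest) b)) (step L Y (≤-reflexive cardY) (solve rest S))
      }
      where
      X = λ i → single v i ∨ Y i
      L′ = reverse X L
      split : flips L v ≡ s + flips L′ v
      split = trans (part L Y Y⊆) (cong (_+ flips L′ v) cardY)
      rest : Cleared L′ v
      rest = go m L′ (≤-pred (≤-trans (+-monoˡ-≤ (flips L′ v) 0<s) (≤-trans (≤-reflexive (≡.sym split)) f≤m)))
      few′ : s + count rest * s < flips L v + s
      few′ = <-≤-trans (+-monoʳ-< s (few rest))
        (≤-reflexive (trans (≡.sym (+-assoc s (flips L′ v) s)) (cong (_+ s) (≡.sym split))))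
      regroup : ∀ p c b → p + (p * c + b) ≡ p * suc c + b
      regroup = solve-∀

  record Removed (L : Marking n) (v : Fin n) : Set where
    field
      rest   : Marking n
      shape  : rest ≈ delete v L
      price  : ℕ
      settle : ∀ {b} → Solved p b rest → Solved p (p * price + b) L

  private
    removed : (L : Marking n) (v : Fin n) (C : Cleared L v) → Removed L v
    removed L v C = record
      { rest = delete v (result C) ; shape = ≈-delete v (result C) L (similar C) ; price = count C
      ; settle = λ S → solve C (solved-delete (clean C) S) }

    count≤1 : ∀ c {f} → f ≤ s → c * s < f + s → c ≤ 1
    count≤1 zero          _   _  = z≤n
    count≤1 (suc zero)    _   _  = ≤-refl
    count≤1 (suc (suc c)) {f} f≤s lt = contradiction lt (≤⇒≯ (begin
      f + s             ≤⟨ +-monoˡ-≤ s f≤s ⟩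
      s + s             ≤⟨ +-monoʳ-≤ s (m≤m+n s (c * s)) ⟩
      s + (s + c * s)   ∎))
      where open ≤-Reasoning

    -- A single inversion is covered by `q ≤ d`. Otherwise the first two cost 2q = `s` + 1 together
    -- and each further one costs `q ≤ s`, in all at most (c - 1)s + 1, and `few` forces at least
    -- that many flips.
    count*q≤ : ∀ c {f d} → f ≤ d → q ≤ d → c * s < f + s → c * q ≤ d
    count*q≤ zero          _   _   _  = z≤n
    count*q≤ (suc zero)    _   q≤d _  = ≤-trans (≤-reflexive (*-identityˡ q)) q≤d
    count*q≤ (suc (suc c)) {f} {d} f≤d _ lt = begin
      q + (q + c * q)         ≤⟨ +-monoʳ-≤ q (+-monoʳ-≤ q (*-monoʳ-≤ c (m≤n+m q r))) ⟩
      q + (q + c * s)         ≡⟨ +-assoc q q (c * s) ⟨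
      suc (s + c * s)         ≤⟨ +-cancelˡ-< s _ _ (≤-trans lt (≤-reflexive (+-comm f s))) ⟩
      f                       ≤⟨ f≤d ⟩
      d                       ∎
      where open ≤-Reasoning

  -- A vertex of degree at least q pays for its own removal.
  solved-high : (L : Marking n) (v : Fin n) → q ≤ deg L v →
                ∃ λ M → M ≈ delete v L × (∀ {b} → Solved p (total M + b) M → Solved p (total L + b) L)
  solved-high L v q≤d = rest , shape , λ {b} S → solved-mono (bound b) (settle S)
    where
    C = clear L v
    open Removed (removed L v C)
    paid : p * count C ≤ deg L v + deg L v
    paid = begin
      (q + q) * count C             ≡⟨ double q (count C) ⟩
      count C * q + count C * q     ≤⟨ +-mono-≤ cq≤d cq≤d ⟩
      deg L v + deg L v             ∎
      where
      open ≤-Reasoning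
      cq≤d = count*q≤ (count C) (flips≤deg L v) q≤d (few C)
      double : ∀ q c → (q + q) * c ≡ c * q + c * q
      double = solve-∀
    bound : ∀ b → p * price + (total rest + b) ≤ total L + b
    bound b = begin
      p * count C + (total rest + b)               ≤⟨ +-monoˡ-≤ _ paid ⟩
      (deg L v + deg L v) + (total rest + b)       ≡⟨ +-assoc (deg L v + deg L v) _ b ⟨
      ((deg L v + deg L v) + total rest) + b       ≡⟨ cong (λ t → ((deg L v + deg L v) + t) + b) (≈-total rest (delete v L) shape) ⟩
      ((deg L v + deg L v) + total (delete v L)) + b ≡⟨ cong (_+ b) (total-delete L v) ⟨
      total L + b                                  ∎
      where open ≤-Reasoning

  -- All neighbours fit into one set with `v`. The full price `p` is charged because the degree may
  -- be too small to pay; the deficit is balanced by the caller.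
  solved-low : (L : Marking n) (v : Fin n) → deg L v ≤ s →
               ∃ λ M → M ≈ delete v L × (∀ {b} → Solved p b M → Solved p (p + b) L)
  solved-low L v d≤s = rest , shape , λ {b} S → solved-mono (+-monoˡ-≤ b paid) (settle S)
    where
    C = clear L v
    open Removed (removed L v C)
    paid : p * count C ≤ p
    paid = ≤-trans (*-monoʳ-≤ p (count≤1 (count C) (≤-trans (flips≤deg L v) d≤s) (few C))) (≤-reflexive (*-identityʳ p))

-- Matchings

-- Twice the number of edges to be flipped.
allFlips : Marking n → ℕ
allFlips L = sum (flips L)

-- Says that `X` is the vertex set of some flip edges each of which is a connected component, so
-- reversing `X` settles these edges and touches no others.
record Batch (L : Marking n) (X : Fin n → Bool) : Set where
  field
    saturated : ∀ i j → X i ≡ true → colour L i j ≡ none ⊎ colour L i j ≡ flip × X j ≡ true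
    exact     : ∀ i → X i ≡ true → flips L i ≡ 1
open Batch

allFlips-reverse : (L : Marking n) (X : Fin n → Bool) → Batch L X → allFlips L ≡ card X + allFlips (reverse X L)
allFlips-reverse L X B = trans (sum-cong-≗ pt) (∑-distrib-+ (bit ∘ X) _)
  where
  pt : ∀ i → flips L i ≡ bit (X i) + flips (reverse X L) i
  pt i with X i in eq
  ... | false = refl
  ... | true  = trans (exact B i eq) (cong suc (≡.sym (sum-zero gone)))
    where
    gone : ∀ j → bit (isFlip (toggle (X j) (colour L i j))) ≡ 0
    gone j with saturated B i j eq
    ... | inj₁ e rewrite e | toggle-none (X j) = refl
    ... | inj₂ (e , Xj) rewrite e | Xj = refl

clean⊎flip : (L : Marking n) → (∀ i j → colour L i j ≢ flip) ⊎ ∃ λ u → ∃ λ v → colour L u v ≡ flip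
clean⊎flip L with any? (λ u → any? λ v → flip? (colour L u v))
  where
  flip? : ∀ c → Dec (c ≡ flip)
  flip? none = no λ ()
  flip? keep = no λ ()
  flip? flip = yes refl
... | yes found = inj₂ found
... | no  none′ = inj₁ λ i j e → none′ (i , j , e)

module _ (L : Marking n) (Δ≤1 : ∀ i → deg L i ≤ 1) where

  -- Flip edges are collected greedily. Either `k` of them are found, with 2k distinct ends, or they
  -- run out earlier and reversing the collected ones leaves nothing to do.
  batch : ∀ k → ∃ λ X → Batch L X ×
          (card X ≡ k + k ⊎ card X ≤ k + k × (∀ i j → colour (reverse X L) i j ≢ flip))
  batch zero = (λ _ → false) , record { saturated = λ _ _ () ; exact = λ _ () } ,
    inj₁ (sum-zero {f = λ (_ : Fin n) → 0} λ _ → refl)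
  batch (suc k) with batch k
  ... | X , B , inj₂ (≤2k , clean) = X , B , inj₂ (≤-trans ≤2k (+-mono-≤ (n≤1+n k) (n≤1+n k)) , clean)
  ... | X , B , inj₁ ≡2k with clean⊎flip (reverse X L)
  ...   | inj₁ clean = X , B , inj₂ (≤-trans (≤-reflexive ≡2k) (+-mono-≤ (n≤1+n k) (n≤1+n k)) , clean)
  ...   | inj₂ (u , v , uv) = X′ , record { saturated = closed′ ; exact = exact′ } , inj₁ card′
    where
    -- An edge that is still `flip` after the reversal avoids `X`, since every edge at `X` has
    -- become `keep`.
    outside : ∀ {a b} → colour (reverse X L) a b ≡ flip → X a ≡ false
    outside {a} {b} e = ≢true⇒false λ Xa → case saturated B a b Xa of λ where
      (inj₁ ab) → case trans (≡.sym e) (trans (cong (toggle (X a ∧ X b)) ab) (toggle-none (X a ∧ X b))) of λ ()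
      (inj₂ (ab , Xb)) → case trans (≡.sym e) (cong₂ toggle (cong₂ _∧_ Xa Xb) ab) of λ ()
    Xu : X u ≡ false
    Xu = outside uv
    Xv : X v ≡ false
    Xv = outside (trans (symmetric (reverse X L) v u) uv)
    uv′ : colour L u v ≡ flip
    uv′ = trans (cong (λ b → toggle (b ∧ X v) (colour L u v)) (≡.sym Xu)) uv
    u≢v : u ≢ v
    u≢v refl = case trans (≡.sym (loopless L u)) uv′ of λ ()
    X′ : Fin n → Bool
    X′ i = X i ∨ (single u i ∨ single v i)
    card′ : card X′ ≡ suc k + suc k
    card′ = begin
      card X′                                              ≡⟨ sum-cong-≗ pt ⟩
      sum (λ i → bit (X i) + (bit (single u i) + bit (single v i)))
        ≡⟨ ∑-distrib-+ (bit ∘ X) (λ i → bit (single u i) + bit (single v i)) ⟩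
      card X + sum (λ i → bit (single u i) + bit (single v i))
        ≡⟨ cong (card X +_) (∑-distrib-+ (bit ∘ single u) (bit ∘ single v)) ⟩
      card X + (card (single u) + card (single v))
        ≡⟨ cong₂ _+_ ≡2k (cong₂ _+_ (card-single u) (card-single v)) ⟩
      (k + k) + 2                                          ≡⟨ two k ⟩
      suc k + suc k                                        ∎
      where
      open ≡.≡-Reasoning
      two : ∀ k → (k + k) + 2 ≡ suc k + suc k
      two = solve-∀
      pt : ∀ i → bit (X′ i) ≡ bit (X i) + (bit (single u i) + bit (single v i))
      pt i with i ≟ u | i ≟ v
      ... | yes refl | yes refl = contradiction refl u≢v
      ... | yes refl | no _  rewrite Xu = refl
      ... | no _ | yes refl  rewrite Xv = refl
      ... | no _ | no _ with X i
      ...   | true  = refl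
      ...   | false = refl
    partner : ∀ {a b} j → colour L a b ≡ flip → colour L a j ≡ none ⊎ colour L a j ≡ flip × j ≡ b
    partner {a} {b} j ab with b ≟ j
    ... | yes refl = inj₂ (ab , refl)
    ... | no b≢j   = inj₁ (size≡0⇒none (n≤0⇒n≡0 (≤-pred (begin
      suc (size (colour L a j))                    ≡⟨ cong (λ c → size c + size (colour L a j)) ab ⟨
      size (colour L a b) + size (colour L a j)    ≤⟨ two-terms-≤ (size ∘ colour L a) b≢j ⟩
      deg L a                                      ≤⟨ Δ≤1 a ⟩
      1                                            ∎))))
      where open ≤-Reasoning
    exactly : ∀ {a b} → colour L a b ≡ flip → flips L a ≡ 1
    exactly {a} {b} ab = ≤-antisym (≤-trans (flips≤deg L a) (Δ≤1 a))
      (≤-trans (≤-reflexive (cong (bit ∘ isFlip) (≡.sym ab))) (term-≤ (bit ∘ isFlip ∘ colour L a) b))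
    vu′ : colour L v u ≡ flip
    vu′ = trans (symmetric L v u) uv′
    closed′ : ∀ i j → X′ i ≡ true → colour L i j ≡ none ⊎ colour L i j ≡ flip × X′ j ≡ true
    closed′ i j X′i with ∨-true {X i} X′i
    ... | inj₁ Xi with saturated B i j Xi
    ...   | inj₁ e = inj₁ e
    ...   | inj₂ (e , Xj) = inj₂ (e , ∨-introˡ Xj)
    closed′ i j X′i | inj₂ e with ∨-true {single u i} e
    ... | inj₁ i≡u rewrite single⇒≡ {a = u} {i} i≡u with partner j uv′
    ...   | inj₁ e′ = inj₁ e′
    ...   | inj₂ (e′ , refl) = inj₂ (e′ , ∨-introʳ {X v} (∨-introʳ {single u v} (single-refl v)))
    closed′ i j X′i | inj₂ e | inj₂ i≡v rewrite single⇒≡ {a = v} {i} i≡v with partner j vu′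
    ...   | inj₁ e′ = inj₁ e′
    ...   | inj₂ (e′ , refl) = inj₂ (e′ , ∨-introʳ {X u} (∨-introˡ (single-refl u)))
    exact′ : ∀ i → X′ i ≡ true → flips L i ≡ 1
    exact′ i X′i with ∨-true {X i} X′i
    ... | inj₁ Xi = exact B i Xi
    ... | inj₂ e with ∨-true {single u i} e
    ...   | inj₁ i≡u rewrite single⇒≡ {a = u} {i} i≡u = exactly uv′
    ...   | inj₂ i≡v rewrite single⇒≡ {a = v} {i} i≡v = exactly vu′

-- A full batch has `p` vertices and lowers `allFlips` by `p`, which pays for it; only a last
-- incomplete batch draws on the spare `p`.
solved-matching : (r : ℕ) (L : Marking n) → (∀ i → deg L i ≤ 1) →
                  let p = suc r + suc r in Solved p (total L + p) L
solved-matching {n} r L Δ≤1 = solved-mono (+-monoˡ-≤ p (sum-mono-≤ (flips≤deg L))) (go (allFlips L) L Δ≤1 ≤-refl)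
  where
  p = suc r + suc r
  go : ∀ m (L : Marking n) → (∀ i → deg L i ≤ 1) → allFlips L ≤ m → Solved p (allFlips L + p) L
  go m L Δ≤1 f≤m with clean⊎flip L
  ... | inj₁ clean = solved-trivial clean (≤-trans (s≤s z≤n) (m≤n+m p (allFlips L)))
  ... | inj₂ (u , v , uv) with batch L Δ≤1 (suc r)
  ...   | X , B , inj₂ (≤p , clean) = solved-mono (≤-trans (≤-reflexive (+-comm p 1)) (+-monoˡ-≤ p 0<flips))
            (solved-reverse X ≤p (solved-trivial {b = 1} clean ≤-refl))
    where
    0<flips : 0 < allFlips L
    0<flips = ≤-trans (≤-reflexive (cong (bit ∘ isFlip) (≡.sym uv)))
      (≤-trans (term-≤ (bit ∘ isFlip ∘ colour L u) v) (term-≤ (flips L) u))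
  ...   | X , B , inj₁ ≡p with m | trans (allFlips-reverse L X B) (cong (_+ allFlips (reverse X L)) ≡p)
  ...     | zero   | e = case subst (_≤ 0) e f≤m of λ ()
  ...     | suc m′ | e = solved-mono (≤-reflexive (trans (≡.sym (+-assoc p _ p)) (cong (_+ p) (≡.sym e))))
              (solved-reverse X (≤-reflexive ≡p) (go m′ (reverse X L)
                (λ i → ≤-trans (≤-reflexive (≈-deg (reverse X L) L (≈-reverse X L) i)) (Δ≤1 i))
                (≤-pred (≤-trans (+-monoˡ-≤ (allFlips (reverse X L)) (s≤s z≤n)) (subst (_≤ suc m′) e f≤m)))))

-- Graphs without a cheap inversion for p = 8

-- An induced subgraph on k vertices of a larger graph, together with the degrees of these vertices
-- in the larger graph; a vertex is open if it has neighbours outside.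
record Pattern (k : ℕ) : Set where
  field
    tint   : Fin k → Fin k → Colour
    degree : Fin k → ℕ

  inner : Fin k → ℕ
  inner i = sum λ j → size (tint i j)
open Pattern

extend : Pattern k → Vec Colour k → ℕ → Pattern (suc k)
extend {k} P r d = record { tint = t ; degree = e }
  where
  t : Fin (suc k) → Fin (suc k) → Colour
  t zero    zero    = none
  t zero    (suc j) = lookup r j
  t (suc i) zero    = lookup r i
  t (suc i) (suc j) = tint P i j
  e : Fin (suc k) → ℕ
  e zero    = d
  e (suc i) = degree P i

Open : Pattern k → Fin k → Set
Open P i = inner P i < degree P i

open? : (P : Pattern k) (i : Fin k) → Dec (Open P i)
open? P i = inner P i <? degree P i

-- Either a degree is exceeded inside the pattern, or there is a compatible pair whose removal
-- deletes at least q = 4 edges. Since `i` has no neighbours outside, a clash could only occur at a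
-- vertex of the pattern, so compatibility there is compatibility in the whole graph.
Refuted : Pattern k → Set
Refuted P = ∃ λ i → degree P i ≤ inner P i × (degree P i < inner P i ⊎
  ∃ λ j → i ≢ j × 4 + size (tint P i j) ≤ degree P i + degree P j × Compatible (tint P) i j)

refuted? : (P : Pattern k) → Dec (Refuted P)
refuted? P = any? λ i → degree P i ≤? inner P i ×-dec (degree P i <? inner P i ⊎-dec
  any? λ j → ¬? (i ≟ j) ×-dec 4 + size (tint P i j) ≤? degree P i + degree P j ×-dec compatible? (tint P) i j)

-- The argument is the sum of the degrees, i.e. twice the number of edges.
Small : ℕ → Set
Small t = t ≤ 14 ⊎ t ≡ 18

-- Quantifies over the rows whose edges all lead to vertices satisfying `R`. The nested form makes
-- the search prune: once `R` fails at a vertex, both of its coloured branches are dropped.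
ForRows : (Fin k → Set) → (Vec Colour k → Set) → Set
ForRows {zero}  R Q = Q []
ForRows {suc k} R Q = ForRows (R ∘ suc) (λ r → Q (none ∷ r)) ×
  (R zero → ForRows (R ∘ suc) (λ r → Q (keep ∷ r)) × ForRows (R ∘ suc) (λ r → Q (flip ∷ r)))

forRows? : {R : Fin k → Set} {Q : Vec Colour k → Set} →
           (∀ i → Dec (R i)) → (∀ r → Dec (Q r)) → Dec (ForRows R Q)
forRows? {zero}  R? Q? = Q? []
forRows? {suc k} R? Q? = forRows? (R? ∘ suc) (λ r → Q? (none ∷ r)) ×-dec
  (R? zero →-dec (forRows? (R? ∘ suc) (λ r → Q? (keep ∷ r)) ×-dec forRows? (R? ∘ suc) (λ r → Q? (flip ∷ r))))

forRows-lookup : {R : Fin k → Set} {Q : Vec Colour k → Set} → ForRows R Q →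
                 (r : Vec Colour k) → (∀ i → 0 < size (lookup r i) → R i) → Q r
forRows-lookup all []         R = all
forRows-lookup (n , _) (none ∷ r) R = forRows-lookup n r (R ∘ suc)
forRows-lookup (_ , e) (keep ∷ r) R = forRows-lookup (proj₁ (e (R zero (s≤s z≤n)))) r (R ∘ suc)
forRows-lookup (_ , e) (flip ∷ r) R = forRows-lookup (proj₂ (e (R zero (s≤s z≤n)))) r (R ∘ suc)

-- New vertices are put at index zero.  Expanding the oldest open vertex first (hence opposite)
-- keeps the search small.
oldestOpen? : (P : Pattern k) → Dec (∃ λ i → Open P (opposite i))
oldestOpen? P = any? λ i → open? P (opposite i)

mutual
  -- A certificate that a stuck marking realising `P`, with a cubic vertex in `P`, has a `Small`
  -- total. The number is fuel, and running out of it counts as failure.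
  Settled : ℕ → Pattern k → Set
  Settled zero    P = ⊥
  Settled (suc f) P = Refuted P ⊎ Branches f P (oldestOpen? P)

  Branches : ℕ → (P : Pattern k) → Dec (∃ λ i → Open P (opposite i)) → Set
  Branches f P (no _)        = Small (sum (degree P))
  Branches f P (yes (i , _)) = ForRows (Open P) λ r → 0 < size (lookup r (opposite i)) →
    Settled f (extend P r 1) × Settled f (extend P r 2) × Settled f (extend P r 3)

mutual
  settled? : ∀ f (P : Pattern k) → Dec (Settled f P)
  settled? zero    P = no λ ()
  settled? (suc f) P = refuted? P ⊎-dec branches? f P (oldestOpen? P)

  branches? : ∀ f (P : Pattern k) o → Dec (Branches f P o)
  branches? f P (no _)        = sum (degree P) ≤? 14 ⊎-dec sum (degree P) ℕₚ.≟ 18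
  branches? f P (yes (i , _)) = forRows? (open? P) λ r → 0 <? size (lookup r (opposite i)) →-dec
    (settled? f (extend P r 1) ×-dec settled? f (extend P r 2) ×-dec settled? f (extend P r 3))

cubicVertex : Pattern 1
cubicVertex = record { tint = λ _ _ → none ; degree = λ _ → 3 }

-- The finite search, carried out by evaluating the decision procedure. Fuel 8 lets a pattern grow
-- from one vertex to eight.
cubicVertex-settled : Settled 8 cubicVertex
cubicVertex-settled = toWitness {a? = settled? 8 cubicVertex} tt

-- The situation for q = 4 in which no vertex pays for its own removal and no compatible pair takes
-- four edges with it.
record Stuck (L : Marking n) : Set where
  field
    subcubic : ∀ i → deg L i ≤ 3
    noPair   : ∀ u v → u ≢ v → 4 + size (colour L u v) ≤ deg L u + deg L v → ¬ Compatible (colour L) u v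

module _ (L : Marking n) (stuck : Stuck L) where
  open Stuck stuck

  record Realised (P : Pattern k) : Set where
    field
      at        : Fin k → Fin n
      injective : Injective _≡_ _≡_ at
      tints     : ∀ i j → colour L (at i) (at j) ≡ tint P i j
      degrees   : ∀ i → deg L (at i) ≡ degree P i

    inner-≡ : ∀ i → inner P i ≡ sum (size ∘ colour L (at i) ∘ at)
    inner-≡ i = sum-cong-≗ λ j → cong size (≡.sym (tints i j))

    inner≤degree : ∀ i → inner P i ≤ degree P i
    inner≤degree i = subst₂ _≤_ (≡.sym (inner-≡ i)) (degrees i)
      (sum-injective-≤ (size ∘ colour L (at i)) at injective)

    Named : Fin n → Set
    Named y = ∃ λ i → at i ≡ y

    named? : ∀ y → Dec (Named y)
    named? y = any? λ i → at i ≟ y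

    with-fresh : Fin n → Fin (suc k) → Fin n
    with-fresh y zero    = y
    with-fresh y (suc i) = at i

    with-fresh-injective : ∀ {y} → ¬ Named y → Injective _≡_ _≡_ (with-fresh y)
    with-fresh-injective fresh {zero}  {zero}  _ = refl
    with-fresh-injective fresh {zero}  {suc j} e = contradiction (j , ≡.sym e) fresh
    with-fresh-injective fresh {suc i} {zero}  e = contradiction (i , e) fresh
    with-fresh-injective fresh {suc i} {suc j} e = cong suc (injective e)

    fresh⇒open : ∀ {y} → ¬ Named y → ∀ i → 0 < size (colour L (at i) y) → Open P i
    fresh⇒open {y} fresh i 0<iy = begin
      1 + inner P i                                                    ≡⟨ cong suc (inner-≡ i) ⟩
      1 + sum (size ∘ colour L (at i) ∘ at)                            ≤⟨ +-monoˡ-≤ _ 0<iy ⟩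
      sum (size ∘ colour L (at i) ∘ with-fresh y)
        ≤⟨ sum-injective-≤ (size ∘ colour L (at i)) (with-fresh y) (with-fresh-injective fresh) ⟩
      deg L (at i)                                                     ≡⟨ degrees i ⟩
      degree P i                                                       ∎
      where open ≤-Reasoning

    closed⇒named : ∀ {i} → degree P i ≤ inner P i → ∀ {y} → 0 < size (colour L (at i) y) → Named y
    closed⇒named {i} deg≤ {y} 0<iy with named? y
    ... | yes named = named
    ... | no  fresh = contradiction (fresh⇒open fresh i 0<iy) (≤⇒≯ deg≤)

    open⇒fresh : ∀ i → Open P i → ∃ λ y → ¬ Named y × 0 < size (colour L (at i) y)
    open⇒fresh i op with any? (λ y → ¬? (named? y) ×-dec 0 <? size (colour L (at i) y))
    ... | yes found = found
    ... | no  none′ = contradiction op (≤⇒≯ (≤-trans (≤-reflexive (≡.sym (degrees i)))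
      (≤-trans (sum-cover-≤ (size ∘ colour L (at i)) at cover) (≤-reflexive (≡.sym (inner-≡ i))))))
      where
      cover : ∀ y → size (colour L (at i) y) ≡ 0 ⊎ Named y
      cover y with named? y
      ... | yes named = inj₂ named
      ... | no  fresh = inj₁ (n≤0⇒n≡0 (≮⇒≥ λ 0<iy → none′ (y , fresh , 0<iy)))

    refute : ¬ Refuted P
    refute (i , deg≤ , inj₁ deg<) = <⇒≱ deg< (inner≤degree i)
    refute (i , deg≤ , inj₂ (j , i≢j , heavy , ≢keep , noClash)) =
      noPair (at i) (at j) (i≢j ∘ injective)
        (subst₂ _≤_ (cong ((4 +_) ∘ size) (≡.sym (tints i j))) (≡.sym (cong₂ _+_ (degrees i) (degrees j))) heavy)
        ((λ e → ≢keep (trans (≡.sym (tints i j)) e)) , λ (w , cl) → clashAt w cl)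
      where
      clashAt : ∀ w → ¬ Clash (colour L (at i) w) (colour L (at j) w)
      clashAt w cl with closed⇒named deg≤ (≤-reflexive (≡.sym (proj₁ (clash⇒edges {colour L (at i) w} cl))))
      ... | l , refl = noClash (l , subst₂ Clash (tints i l) (tints j l) cl)

    -- A closed pattern is a union of components. A non-isolated vertex elsewhere would have no
    -- common neighbour with the cubic vertex, hence be compatible with it, and removing both would
    -- delete at least 3 + 1 edges.
    total-closed : (∀ i → degree P i ≤ inner P i) → (∃ λ i → degree P i ≡ 3) → total L ≡ sum (degree P)
    total-closed closed (t , t≡3) = ≤-antisym
      (≤-trans (sum-cover-≤ (deg L) at cover) (≤-reflexive (sum-cong-≗ degrees)))
      (≤-trans (≤-reflexive (≡.sym (sum-cong-≗ degrees))) (sum-injective-≤ (deg L) at injective))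
      where
      apart : ∀ {y} → ¬ Named y → ∀ i → colour L (at i) y ≡ none
      apart fresh i = size≡0⇒none (n≤0⇒n≡0 (≮⇒≥ λ 0<iy → fresh (closed⇒named (closed i) 0<iy)))
      cover : ∀ y → deg L y ≡ 0 ⊎ Named y
      cover y with named? y
      ... | yes named = inj₂ named
      ... | no  fresh = inj₁ (n≤0⇒n≡0 (≮⇒≥ λ 0<y → noPair (at t) y (λ e → fresh (t , e)) (heavy 0<y)
          ((λ e → case trans (≡.sym e) (apart fresh t) of λ ()) , λ (w , cl) → clashAt w cl)))
        where
        heavy : 0 < deg L y → 4 + size (colour L (at t) y) ≤ deg L (at t) + deg L y
        heavy 0<y rewrite apart fresh t | degrees t | t≡3 = +-monoʳ-≤ 3 0<y
        clashAt : ∀ w → ¬ Clash (colour L (at t) w) (colour L y w)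
        clashAt w cl with closed⇒named (closed t) (≤-reflexive (≡.sym (proj₁ (clash⇒edges {colour L (at t) w} cl))))
        ... | l , refl = case trans (≡.sym (proj₂ (clash⇒edges {colour L (at t) (at l)} cl)))
          (cong size (trans (symmetric L y (at l)) (apart fresh l))) of λ ()

    extended : ∀ y → ¬ Named y → Realised (extend P (tabulate λ i → colour L (at i) y) (deg L y))
    extended y fresh = record
      { at = with-fresh y ; injective = with-fresh-injective fresh ; tints = tints′ ; degrees = degrees′ }
      where
      row = λ i → colour L (at i) y
      tints′ : ∀ i j → colour L (with-fresh y i) (with-fresh y j) ≡ tint (extend P (tabulate row) (deg L y)) i j
      tints′ zero    zero    = loopless L y
      tints′ zero    (suc j) = trans (symmetric L y (at j)) (≡.sym (lookup∘tabulate row j))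
      tints′ (suc i) zero    = ≡.sym (lookup∘tabulate row i)
      tints′ (suc i) (suc j) = tints i j
      degrees′ : ∀ i → deg L (with-fresh y i) ≡ degree (extend P (tabulate row) (deg L y)) i
      degrees′ zero    = refl
      degrees′ (suc i) = degrees i

  open Realised

  -- The marking selects the branch: a neighbour outside the pattern is adjacent to open vertices
  -- only, so its row is among those examined, and its degree is 1, 2 or 3.
  settled⇒small : ∀ f {P : Pattern k} → Settled f P → Realised P → (∃ λ i → degree P i ≡ 3) → Small (total L)
  settled⇒small (suc f) (inj₁ ref) R _ = contradiction ref (refute R)
  settled⇒small (suc f) {P} (inj₂ br) R (t , t≡3) with oldestOpen? P
  ... | no none′ = subst Small (≡.sym (total-closed R closed (t , t≡3))) br
    where
    closed : ∀ i → degree P i ≤ inner P i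
    closed i = ≮⇒≥ λ op → none′ (opposite i , subst (Open P) (≡.sym (opposite-involutive i)) op)
  ... | yes (i , op) with open⇒fresh R (opposite i) op
  ...   | y , fresh , 0<iy = choose (deg L y) refl (subcubic y)
    where
    row = λ i → colour L (at R i) y
    edge : ∀ j → size (lookup (tabulate row) j) ≡ size (row j)
    edge j = cong size (lookup∘tabulate row j)
    branches : Settled f (extend P (tabulate row) 1) × Settled f (extend P (tabulate row) 2) × Settled f (extend P (tabulate row) 3)
    branches = forRows-lookup br (tabulate row)
      (λ j 0<j → fresh⇒open R fresh j (subst (0 <_) (edge j) 0<j)) (subst (0 <_) (≡.sym (edge (opposite i))) 0<iy)
    R′ : ∀ {d} → deg L y ≡ d → Realised (extend P (tabulate row) d)
    R′ refl = extended R y fresh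
    0<y : 0 < deg L y
    0<y = ≤-trans 0<iy (≤-trans (≤-reflexive (cong size (symmetric L (at R (opposite i)) y)))
      (term-≤ (size ∘ colour L y) (at R (opposite i))))
    choose : ∀ d → deg L y ≡ d → d ≤ 3 → Small (total L)
    choose 0 e _ = contradiction 0<y (<-irrefl (≡.sym e))
    choose 1 e _ = settled⇒small f (proj₁ branches) (R′ e) (suc t , t≡3)
    choose 2 e _ = settled⇒small f (proj₁ (proj₂ branches)) (R′ e) (suc t , t≡3)
    choose 3 e _ = settled⇒small f (proj₂ (proj₂ branches)) (R′ e) (suc t , t≡3)
    choose (suc (suc (suc (suc _)))) _ (s≤s (s≤s (s≤s ())))

  stuck⇒small : ∀ v → deg L v ≡ 3 → Small (total L)
  stuck⇒small v d≡3 = settled⇒small 8 {cubicVertex} cubicVertex-settled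
    (record { at = λ _ → v ; injective = λ { {zero} {zero} _ → refl } ; tints = λ _ _ → loopless L v ; degrees = λ _ → d≡3 })
    (zero , refl)

-- Upper bounds

by-total : {P : Marking n → Set} → (∀ L → (∀ M → total M < total L → P M) → P L) → ∀ L → P L
by-total {P = P} step = wfRec P λ L rec → step L λ M lt → rec lt
  where
  open WF.All (wellFounded total <-wellFounded) _

-- The inequality between `p` and the degrees says that at least p/2 edges disappear, so the drop of
-- `total` pays for the inversion.
solved-by-pair : {p b : ℕ} (L : Marking n) {u v : Fin n} → 0 < p → u ≢ v → Compatible (colour L) u v →
                 2 + (flips L u + flips L v) ≤ p →
                 p + (size (colour L u v) + size (colour L u v)) ≤ (deg L u + deg L v) + (deg L u + deg L v) →
                 (∀ M → total M < total L → Solved p (total M + b) M) → Solved p (total L + b) L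
solved-by-pair {p = p} {b} L {u} {v} 0<p u≢v comp small heavy rec =
  solved-mono (≤-trans (≤-reflexive (≡.sym (+-assoc p (total M) b))) (+-monoˡ-≤ b p+M≤L))
    (solved-pair L u v comp small (rec M (<-≤-trans (+-monoˡ-≤ (total M) 0<p) p+M≤L)))
  where
  M = removePair L u v
  a = size (colour L v u)
  d = deg L u + deg L v
  p+M≤L : p + total M ≤ total L
  p+M≤L = +-cancelʳ-≤ (a + a) _ _ (begin
    (p + total M) + (a + a)   ≡⟨ swap p (total M) (a + a) ⟩
    (p + (a + a)) + total M   ≤⟨ +-monoˡ-≤ (total M) (subst (λ c → p + (size c + size c) ≤ d + d) (symmetric L u v) heavy) ⟩
    (d + d) + total M         ≡⟨ total-removePair L u v u≢v ⟨
    total L + (a + a)         ∎)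
    where
    open ≤-Reasoning
    swap : ∀ x y z → (x + y) + z ≡ (x + z) + y
    swap = solve-∀

solved-by-high : (r : ℕ) {b : ℕ} (L : Marking n) (v : Fin n) → suc r ≤ deg L v → let p = suc r + suc r in
                 (∀ M → total M < total L → Solved p (total M + b) M) → Solved p (total L + b) L
solved-by-high r L v q≤d rec with solved-high r L v q≤d
... | M , shape , settle = settle (rec M (begin-strict
  total M                                     ≡⟨ ≈-total M (delete v L) shape ⟩
  total (delete v L)                          <⟨ +-monoˡ-≤ (total (delete v L)) (≤-trans (s≤s z≤n) (≤-trans q≤d (m≤m+n _ (deg L v)))) ⟩
  (deg L v + deg L v) + total (delete v L)    ≡⟨ total-delete L v ⟨
  total L                                     ∎))
  where open ≤-Reasoning

degree≥? : (L : Marking n) (d : ℕ) → (∃ λ v → suc d ≤ deg L v) ⊎ (∀ v → deg L v ≤ d)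
degree≥? L d with any? (λ v → suc d ≤? deg L v)
... | yes found = inj₁ found
... | no  none′ = inj₂ λ v → ≮⇒≥ λ d<v → none′ (v , d<v)

-- If v, c, e are independent of degree two then (v , c) is compatible, or else a common neighbour
-- of v and c has no neighbour in common with e.
compatible-pair : (L : Marking n) → (∀ i → deg L i ≤ 2) → ∀ {v c e} → v ≢ c → v ≢ e → c ≢ e →
                  colour L v c ≡ none → colour L v e ≡ none → colour L c e ≡ none →
                  2 ≤ deg L v → 2 ≤ deg L c → 2 ≤ deg L e →
                  ∃ λ a → ∃ λ b → a ≢ b × colour L a b ≡ none × Compatible (colour L) a b × 2 ≤ deg L a × 2 ≤ deg L b
compatible-pair L Δ≤2 {v} {c} {e} v≢c v≢e c≢e vc ve ce 2≤v 2≤c 2≤e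
  with any? (λ w → clash? (colour L v w) (colour L c w))
... | no noClash = v , c , v≢c , vc , ((λ k → case trans (≡.sym k) vc of λ ()) , noClash) , 2≤v , 2≤c
... | yes (w , cl) = w , e , w≢e , we , ((λ k → case trans (≡.sym k) we of λ ()) , λ (x , cl′) → noClash x cl′) , 2≤w , 2≤e
  where
  wv : size (colour L w v) ≡ 1
  wv = trans (cong size (symmetric L w v)) (proj₁ (clash⇒edges {colour L v w} cl))
  wc : size (colour L w c) ≡ 1
  wc = trans (cong size (symmetric L w c)) (proj₂ (clash⇒edges {colour L v w} cl))
  2≤w : 2 ≤ deg L w
  2≤w = subst (_≤ deg L w) (cong₂ _+_ wv wc) (two-terms-≤ (size ∘ colour L w) v≢c)
  w≢e : w ≢ e
  w≢e refl = case trans (≡.sym (proj₁ (clash⇒edges {colour L v w} cl))) (cong size ve) of λ ()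
  noThird : ∀ x → v ≢ x → c ≢ x → size (colour L w x) ≡ 0
  noThird x v≢x c≢x = n≤0⇒n≡0 (+-cancelˡ-≤ 2 _ _ (≤-trans
    (subst₂ (λ a b → a + (b + size (colour L w x)) ≤ deg L w) wv wc (three-terms-≤ (size ∘ colour L w) v≢c v≢x c≢x)) (Δ≤2 w)))
  we : colour L w e ≡ none
  we = size≡0⇒none (noThird e v≢e c≢e)
  noClash : ∀ x → ¬ Clash (colour L w x) (colour L e x)
  noClash x cl′ = case trans (≡.sym (proj₁ (clash⇒edges {colour L w x} cl′))) (noThird x (off ve) (off ce)) of λ ()
    where
    off : ∀ {y} → colour L y e ≡ none → y ≢ x
    off ye refl = case trans (≡.sym (proj₂ (clash⇒edges {colour L w x} cl′))) (cong size (trans (symmetric L e x) ye)) of λ ()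

-- With degree at most two before the deletion and at least two after it, `c` has lost no edge.
delete-far : (L : Marking n) {v c : Fin n} → deg L c ≤ 2 → 2 ≤ deg (delete v L) c →
             v ≢ c × colour L v c ≡ none × 2 ≤ deg L c
delete-far L {v} {c} c≤2 2≤c = v≢c , vc , ≤-trans 2≤c (deg-delete-≤ L v c)
  where
  v≢c : v ≢ c
  v≢c refl = contradiction (≤-trans 2≤c (≤-reflexive (sum-zero λ j → cong size (delete-hitˡ L v j)))) λ ()
  vc : colour L v c ≡ none
  vc = trans (symmetric L v c) (size≡0⇒none (n≤0⇒n≡0 (+-cancelʳ-≤ 2 _ _ (begin
    size (colour L c v) + 2                      ≤⟨ +-monoʳ-≤ _ 2≤c ⟩
    size (colour L c v) + deg (delete v L) c     ≡⟨ deg-delete L (v≢c ∘ ≡.sym) ⟨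
    deg L c                                      ≤⟨ c≤2 ⟩
    2                                            ∎))))
    where open ≤-Reasoning

total-rest : (L M : Marking n) (v : Fin n) {d : ℕ} → M ≈ delete v L → d ≤ deg L v → (d + d) + total M ≤ total L
total-rest L M v {d} shape d≤v = begin
  (d + d) + total M                          ≡⟨ cong ((d + d) +_) (≈-total M (delete v L) shape) ⟩
  (d + d) + total (delete v L)               ≤⟨ +-monoˡ-≤ _ (+-mono-≤ d≤v d≤v) ⟩
  (deg L v + deg L v) + total (delete v L)   ≡⟨ total-delete L v ⟨
  total L                                    ∎
  where open ≤-Reasoning

-- Vertices of degree two are deleted until a matching is left, which needs one spare `p`. A single
-- deletion is covered by the other spare `p`. Two deletions remove four edges, so `total` drops by
-- 8, and `p ≤ 8` covers the second. A third such vertex gives a compatible pair that pays for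
-- itself.
solved-paths : (r : ℕ) → 2 ≤ r → r ≤ 3 → let p = suc r + suc r in
               (L : Marking n) → (∀ i → deg L i ≤ 2) →
               (∀ M → total M < total L → Solved p (total M + (p + p)) M) → Solved p (total L + (p + p)) L
solved-paths r 2≤r r≤3 L Δ≤2 rec with degree≥? L 1
... | inj₂ Δ≤1 = solved-mono (+-monoʳ-≤ (total L) (m≤m+n _ _)) (solved-matching r L Δ≤1)
... | inj₁ (v , 2≤v) with solved-low r L v (≤-trans (Δ≤2 v) (≤-trans 2≤r (m≤m+n r _)))
... | L₁ , shape₁ , settle₁ with degree≥? L₁ 1
...   | inj₂ Δ≤1 = solved-mono (begin
        p + (total L₁ + p)   ≡⟨ swap p (total L₁) ⟩
        total L₁ + (p + p)   ≤⟨ +-monoˡ-≤ (p + p) (≤-trans (m≤n+m (total L₁) 4) (total-rest L L₁ v shape₁ 2≤v)) ⟩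
        total L + (p + p)    ∎) (settle₁ (solved-matching r L₁ Δ≤1))
  where
  open ≤-Reasoning
  p = suc r + suc r
  swap : ∀ p t → p + (t + p) ≡ t + (p + p)
  swap = solve-∀
...   | inj₁ (c , 2≤c) with solved-low r L₁ c (≤-trans (Δ₁≤2 c) (≤-trans 2≤r (m≤m+n r _)))
  where
  Δ₁≤2 : ∀ i → deg L₁ i ≤ 2
  Δ₁≤2 i = ≤-trans (≤-reflexive (≈-deg L₁ (delete v L) shape₁ i)) (≤-trans (deg-delete-≤ L v i) (Δ≤2 i))
...   | L₂ , shape₂ , settle₂ with degree≥? L₂ 1
...     | inj₂ Δ≤1 = solved-mono (begin
        p + (p + (total L₂ + p))   ≡⟨ swap p (total L₂) ⟩
        (p + total L₂) + (p + p)   ≤⟨ +-monoˡ-≤ (p + p) (≤-trans (+-monoˡ-≤ (total L₂) (+-mono-≤ (s≤s r≤3) (s≤s r≤3)))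
          (≤-trans (+-monoʳ-≤ 4 (total-rest L₁ L₂ c shape₂ 2≤c)) (total-rest L L₁ v shape₁ 2≤v))) ⟩
        total L + (p + p)          ∎) (settle₁ (settle₂ (solved-matching r L₂ Δ≤1)))
  where
  open ≤-Reasoning
  p = suc r + suc r
  swap : ∀ p t → p + (p + (t + p)) ≡ (p + t) + (p + p)
  swap = solve-∀
...     | inj₁ (e , 2≤e) = result
  where
  p = suc r + suc r
  Δ₁≤2 : ∀ i → deg L₁ i ≤ 2
  Δ₁≤2 i = ≤-trans (≤-reflexive (≈-deg L₁ (delete v L) shape₁ i)) (≤-trans (deg-delete-≤ L v i) (Δ≤2 i))
  -- Both `c` and `e` still have degree two after the earlier deletions, so `v`, `c`, `e` are
  -- independent.
  farC = delete-far L {v} {c} (Δ≤2 c) (subst (2 ≤_) (≈-deg L₁ (delete v L) shape₁ c) 2≤c)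
  farE₁ = delete-far L₁ {c} {e} (Δ₁≤2 e) (subst (2 ≤_) (≈-deg L₂ (delete c L₁) shape₂ e) 2≤e)
  farE = delete-far L {v} {e} (Δ≤2 e) (subst (2 ≤_) (≈-deg L₁ (delete v L) shape₁ e) (proj₂ (proj₂ farE₁)))
  ce : colour L c e ≡ none
  ce = trans (≡.sym (delete-miss L (proj₁ farC ∘ ≡.sym) (proj₁ farE ∘ ≡.sym)))
    (size≡0⇒none (trans (≡.sym (shape₁ c e)) (cong size (proj₁ (proj₂ farE₁)))))
  result : Solved p (total L + (p + p)) L
  result with compatible-pair L Δ≤2 (proj₁ farC) (proj₁ farE) (proj₁ farE₁) (proj₁ (proj₂ farC)) (proj₁ (proj₂ farE)) ce
                2≤v (proj₂ (proj₂ farC)) (proj₂ (proj₂ farE))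
  -- The set has at most 2 + 2 + 2 vertices, which fits by `2 ≤ r`; four edges disappear, which is
  -- enough by `r ≤ 3`.
  ... | a , b , a≢b , ab , comp , 2≤a , 2≤b = solved-by-pair L (s≤s z≤n) a≢b comp
    (≤-trans (+-monoʳ-≤ 2 (+-mono-≤ (≤-trans (flips≤deg L a) (Δ≤2 a)) (≤-trans (flips≤deg L b) (Δ≤2 b))))
      (+-mono-≤ (s≤s 2≤r) (s≤s 2≤r)))
    (begin
      p + (size (colour L a b) + size (colour L a b))   ≡⟨ cong (λ k → p + (size k + size k)) ab ⟩
      p + 0                                             ≡⟨ +-identityʳ p ⟩
      p                                                 ≤⟨ +-mono-≤ (s≤s r≤3) (s≤s r≤3) ⟩
      4 + 4                                             ≤⟨ +-mono-≤ (+-mono-≤ 2≤a 2≤b) (+-mono-≤ 2≤a 2≤b) ⟩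
      (deg L a + deg L b) + (deg L a + deg L b)         ∎)
    rec
    where open ≤-Reasoning

-- Integrality: fewer than k + 1 sets are at most `k` sets.
solved-floor : {p : ℕ} {L : Marking n} (k : ℕ) → Solved p (p * suc k) L → Solved p (p * k + 1) L
solved-floor {p = p} k S = record
  { sets = sets S ; bounded = bounded S ; fixes = fixes S
  ; short = subst (p * length (sets S) <_) (+-comm 1 (p * k))
      (s≤s (*-monoʳ-≤ p (≤-pred (*-cancelˡ-< p (length (sets S)) (suc k) (short S))))) }

-- With at most 2k edges, `k` inversions suffice: a vertex of degree at least two takes two edges
-- off with one inversion, and a matching is settled four edges at a time.
solved-few : (k : ℕ) (L : Marking n) → (∀ i → deg L i ≤ 3) → total L ≤ 4 * k → Solved 8 (8 * k + 1) L
solved-few zero L _ t≤0 = solved-trivial clean (s≤s z≤n)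
  where
  clean : ∀ i j → colour L i j ≢ flip
  clean i j e = contradiction (≤-trans (≤-reflexive (cong size (≡.sym e)))
    (≤-trans (term-≤ (size ∘ colour L i) j) (≤-trans (term-≤ (deg L) i) t≤0))) λ ()
solved-few (suc k) L Δ≤3 t≤ with degree≥? L 1
... | inj₂ Δ≤1 = solved-floor (suc k) (solved-mono (begin
    total L + 8            ≤⟨ +-monoˡ-≤ 8 t≤ ⟩
    4 * suc k + 8          ≤⟨ +-monoˡ-≤ 8 (*-monoˡ-≤ (suc k) {4} {8} (toWitness {a? = 4 ≤? 8} tt)) ⟩
    8 * suc k + 8          ≡⟨ next k ⟩
    8 * suc (suc k)        ∎) (solved-matching 3 L Δ≤1))
  where
  open ≤-Reasoning
  next : ∀ k → 8 * suc k + 8 ≡ 8 * suc (suc k)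
  next = solve-∀
... | inj₁ (v , 2≤v) with solved-low 3 L v (≤-trans (Δ≤3 v) (toWitness {a? = 3 ≤? 7} tt))
...   | M , shape , settle = solved-mono (≤-reflexive (next k)) (settle (solved-few k M Δ′≤3
        (+-cancelˡ-≤ 4 _ _ (≤-trans (total-rest L M v shape 2≤v) (≤-trans t≤ (≤-reflexive (*-suc 4 k)))))))
  where
  next : ∀ k → 8 + (8 * k + 1) ≡ 8 * suc k + 1
  next = solve-∀
  Δ′≤3 : ∀ i → deg M i ≤ 3
  Δ′≤3 i = ≤-trans (≤-reflexive (≈-deg M (delete v L) shape i)) (≤-trans (deg-delete-≤ L v i) (Δ≤3 i))

-- The cubic vertex goes first and takes three edges; `k` further inversions do if `total` is at
-- most 6 + 4k. The choices k = 1, 2, 3 stay within the allowance for totals up to 8, from 9 to 14,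
-- and 18. A total of 16 would also require k = 3, but 33 exceeds 16 + 16, which is why `Small`
-- omits it.
solved-small : (L : Marking n) → (∀ i → deg L i ≤ 3) → (v : Fin n) → 3 ≤ deg L v → Small (total L) →
               Solved 8 (total L + 16) L
solved-small L Δ≤3 v 3≤v small with solved-low 3 L v (≤-trans (Δ≤3 v) (toWitness {a? = 3 ≤? 7} tt))
... | M , shape , settle = cases small
  where
  6+M≤L : 6 + total M ≤ total L
  6+M≤L = total-rest L M v shape 3≤v
  few : ∀ k → total L ≤ 6 + 4 * k → 8 + (8 * k + 1) ≤ total L + 16 → Solved 8 (total L + 16) L
  few k L≤ bound = solved-mono bound (settle (solved-few k M
    (λ i → ≤-trans (≤-reflexive (≈-deg M (delete v L) shape i)) (≤-trans (deg-delete-≤ L v i) (Δ≤3 i)))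
    (+-cancelˡ-≤ 6 _ _ (≤-trans 6+M≤L L≤))))
  cases : Small (total L) → Solved 8 (total L + 16) L
  cases (inj₁ L≤14) with total L ≤? 8
  ... | yes L≤8 = few 1 (≤-trans L≤8 (m≤m+n 8 2)) (+-monoˡ-≤ 16 (≤-trans (s≤s z≤n) 6+M≤L))
  ... | no  L≰8 = few 2 L≤14 (+-monoˡ-≤ 16 (≰⇒> L≰8))
  cases (inj₂ L≡18) = few 3 (≤-reflexive L≡18) (≤-trans (m≤m+n 33 1) (+-monoˡ-≤ 16 (≤-reflexive (≡.sym L≡18))))

-- Induction on the number of edges

solved-≤5 : (r : ℕ) → r ≤ 1 → let p = suc r + suc r in (L : Marking n) → Solved p (total L + p) L
solved-≤5 r r≤1 = by-total step
  where
  step : ∀ L → _ → _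
  step L rec with degree≥? L 1
  ... | inj₁ (v , 2≤v) = solved-by-high r L v (≤-trans (s≤s r≤1) 2≤v) rec
  ... | inj₂ Δ≤1       = solved-matching r L Δ≤1

solved-6 : (L : Marking n) → Solved 6 (total L + 12) L
solved-6 = by-total step
  where
  step : ∀ L → _ → _
  step L rec with degree≥? L 2
  ... | inj₁ (v , 3≤v) = solved-by-high 2 L v 3≤v rec
  ... | inj₂ Δ≤2       = solved-paths 2 ≤-refl (n≤1+n 2) L Δ≤2 rec

-- The reductions that pay for themselves come first; the additive constant is drawn on only when
-- both fail and the marking is stuck.
solved-8 : (L : Marking n) → Solved 8 (total L + 16) L
solved-8 = by-total step
  where
  step : ∀ L → _ → _
  step L rec with degree≥? L 3
  ... | inj₁ (v , 4≤v) = solved-by-high 3 L v 4≤v rec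
  ... | inj₂ Δ≤3 with any? (λ u → any? λ v → ¬? (u ≟ v) ×-dec 4 + size (colour L u v) ≤? deg L u + deg L v
                                              ×-dec compatible? (colour L) u v)
  ...   | yes (u , v , u≢v , heavy , comp) = solved-by-pair L (s≤s z≤n) u≢v comp
          (+-monoʳ-≤ 2 (+-mono-≤ (≤-trans (flips≤deg L u) (Δ≤3 u)) (≤-trans (flips≤deg L v) (Δ≤3 v))))
          (≤-trans (≤-reflexive (double (size (colour L u v)))) (+-mono-≤ heavy heavy)) rec
    where
    double : ∀ a → 8 + (a + a) ≡ (4 + a) + (4 + a)
    double = solve-∀
  ...   | no noPair with degree≥? L 2
  ...     | inj₂ Δ≤2 = solved-paths 3 (n≤1+n 2) ≤-refl L Δ≤2 rec
  ...     | inj₁ (v , 3≤v) = solved-small L Δ≤3 v 3≤v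
            (stuck⇒small L (record { subcubic = Δ≤3 ; noPair = λ u v u≢v heavy comp → noPair (u , v , u≢v , heavy , comp) })
              v (≤-antisym (Δ≤3 v) 3≤v))

-- From pairs of orientations to markings

open ℤ using (+_; -[1+_])

mark : Bool → Bool → Colour
mark false _     = none
mark true  false = keep
mark true  true  = flip

-- Two reversals of the same arc cancel, so only the parity of the number of sets containing both
-- ends matters.
invertAll-parity : (Xs : List (Fin n → Bool)) (a : Arcs n) → ∀ i j →
  invertAll (map tabulate Xs) a i j ≡ (if parity Xs i j then a j i else a i j)
invertAll-parity []       a i j = refl
invertAll-parity (X ∷ Xs) a i j
  rewrite invertAll-parity Xs (invert (tabulate X) a) i j | lookup∘tabulate X i | lookup∘tabulate X j
  with X i | X j | parity Xs i j
... | false | false | false = refl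
... | false | false | true  = refl
... | false | true  | false = refl
... | false | true  | true  = refl
... | true  | false | false = refl
... | true  | false | true  = refl
... | true  | true  | false = refl
... | true  | true  | true  = refl

module _ (G : Graph n) where

  private
    below : Fin n → Fin n → Bool
    below i j = adj G i j ∧ does (toℕ i <? toℕ j)

    edges : List (Fin n × Fin n) → ℕ
    edges = length ∘ filter (λ ij → toℕ (proj₁ ij) <? toℕ (proj₂ ij))
                   ∘ filter (λ ij → adj G (proj₁ ij) (proj₂ ij) ≟ᵇ true)

    edges-++ : ∀ xs ys → edges (xs ++ ys) ≡ edges xs + edges ys
    edges-++ xs ys = trans (cong (length ∘ filter _) (filter-++ _ xs ys))
      (trans (cong length (filter-++ _ (filter _ xs) (filter _ ys))) (length-++ (filter _ (filter _ xs))))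

    edges-row : ∀ {m} i (g : Fin m → Fin n) →
                edges (map (i ,_) (List.tabulate g)) ≡ sum (λ j → bit (below i (g j)))
    edges-row {zero}  i g = refl
    edges-row {suc m} i g with adj G i (g zero)
    ... | false = edges-row i (g ∘ suc)
    ... | true with does (toℕ i <? toℕ (g zero))
    ...   | false = edges-row i (g ∘ suc)
    ...   | true  = cong suc (edges-row i (g ∘ suc))

    edges-rows : ∀ {m} (g : Fin m → Fin n) →
                 edges (concatMap (λ i → map (i ,_) (allFin n)) (List.tabulate g)) ≡ sum (λ i → card (below (g i)))
    edges-rows {zero}  g = refl
    edges-rows {suc m} g = trans (edges-++ (map (g zero ,_) (allFin n)) _)
      (cong₂ _+_ (edges-row (g zero) (λ j → j)) (edges-rows (g ∘ suc)))

    adj-split : ∀ i j → bit (adj G i j) ≡ bit (below i j) + bit (below j i)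
    adj-split i j rewrite Defs.sym G j i with i ≟ j
    ... | yes refl rewrite irrefl G i = refl
    ... | no i≢j with adj G i j
    ...   | false = refl
    ...   | true  = one-of (<-cmp (toℕ i) (toℕ j))
      where
      one-of : Tri (toℕ i < toℕ j) (toℕ i ≡ toℕ j) (toℕ j < toℕ i) →
               1 ≡ bit (does (toℕ i <? toℕ j)) + bit (does (toℕ j <? toℕ i))
      one-of (tri< lt _ ≯) rewrite dec-true (toℕ i <? toℕ j) lt | dec-false (toℕ j <? toℕ i) ≯ = refl
      one-of (tri≈ _ eq _) = contradiction (toℕ-injective eq) i≢j
      one-of (tri> ≮ _ gt) rewrite dec-false (toℕ i <? toℕ j) ≮ | dec-true (toℕ j <? toℕ i) gt = refl

  -- Every adjacent ordered pair is increasing or decreasing. The increasing ones are those listed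
  -- by `edgeCount`, and exchanging the two sums turns the decreasing ones into them.
  handshake : sum (λ i → card (adj G i)) ≡ edgeCount G + edgeCount G
  handshake = begin
    sum (λ i → card (adj G i))
      ≡⟨ sum-cong-≗ (λ i → trans (sum-cong-≗ (adj-split i)) (∑-distrib-+ (bit ∘ below i) (λ j → bit (below j i)))) ⟩
    sum (λ i → card (below i) + sum (λ j → bit (below j i)))
      ≡⟨ ∑-distrib-+ (card ∘ below) (λ i → sum λ j → bit (below j i)) ⟩
    sum (card ∘ below) + sum (λ i → sum λ j → bit (below j i))
      ≡⟨ cong (λ t → sum (card ∘ below) + t) (∑-comm (λ i j → bit (below j i))) ⟩
    sum (card ∘ below) + sum (card ∘ below)
      ≡⟨ cong₂ _+_ (edges-rows (λ i → i)) (edges-rows (λ i → i)) ⟨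
    edgeCount G + edgeCount G ∎
    where open ≡.≡-Reasoning

  arc-opposite : (D : Orientation G) → ∀ i j → adj G i j ≡ true → arc D j i ≡ not (arc D i j)
  arc-opposite D i j e with arc D i j | arc D j i | oriented D i j e
  ... | false | true  | _ = refl
  ... | true  | false | _ = refl

  module _ (D₁ D₂ : Orientation G) where

    difference : Marking n
    difference = record { colour = c ; symmetric = s ; loopless = λ i → cong (λ b → mark b _) (irrefl G i) }
      where
      c : Fin n → Fin n → Colour
      c i j = mark (adj G i j) (arc D₁ i j xor arc D₂ i j)
      xor-not : ∀ a b → a xor b ≡ not a xor not b
      xor-not false false = refl
      xor-not false true  = refl
      xor-not true  false = refl
      xor-not true  true  = refl
      s : ∀ i j → c i j ≡ c j i
      s i j rewrite Defs.sym G j i with adj G i j in e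
      ... | false = refl
      ... | true rewrite arc-opposite D₁ i j e | arc-opposite D₂ i j e = cong (mark true) (xor-not (arc D₁ i j) (arc D₂ i j))

    total-difference : total difference ≡ edgeCount G + edgeCount G
    total-difference = trans (sum-cong-≗ λ i → sum-cong-≗ λ j → size-mark (adj G i j) _) handshake
      where
      size-mark : ∀ a b → size (mark a b) ≡ bit a
      size-mark false _     = refl
      size-mark true  false = refl
      size-mark true  true  = refl

    solved⇒transforms : ∀ {p₀ p b} → p₀ ≤ p → (S : Solved p₀ b difference) →
                        Transforms p (map tabulate (sets S)) (arc D₁) (arc D₂)
    solved⇒transforms {p₀} {p} p₀≤p S = sizes (bounded S) , λ i j → trans (invertAll-parity (sets S) (arc D₁) i j) (target i j)
      where
      card-tabulate : ∀ {m} (X : Fin m → Bool) → ∣ tabulate X ∣ ≡ card X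
      card-tabulate {zero}  X = refl
      card-tabulate {suc m} X with X zero
      ... | false = card-tabulate (X ∘ suc)
      ... | true  = cong suc (card-tabulate (X ∘ suc))
      sizes : ∀ {Xs} → All (λ X → card X ≤ p₀) Xs → All (λ X → ∣ X ∣ ≤ p) (map tabulate Xs)
      sizes []               = []
      sizes {X ∷ _} (x ∷ xs) = ≤-trans (≤-reflexive (card-tabulate X)) (≤-trans x p₀≤p) ∷ sizes xs
      target : ∀ i j → (if parity (sets S) i j then arc D₁ j i else arc D₁ i j) ≡ arc D₂ i j
      target i j with parity (sets S) i j | adj G i j in e | fixes S i j
      ... | false | false | _ = trans (nonEdge D₁ i j e) (≡.sym (nonEdge D₂ i j e))
      ... | true  | false | _ = trans (nonEdge D₁ j i (trans (Defs.sym G j i) e)) (≡.sym (nonEdge D₂ i j e))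
      ... | false | true  | f with arc D₁ i j | arc D₂ i j
      ...   | false | false = refl
      ...   | true  | true  = refl
      ...   | false | true  = contradiction refl f
      ...   | true  | false = contradiction refl f
      target i j | true | true | f rewrite arc-opposite D₁ i j e with arc D₁ i j | arc D₂ i j
      ...   | false | true  = refl
      ...   | true  | false = refl
      ...   | false | false = contradiction refl f
      ...   | true  | true  = contradiction refl f

-- Both sides are even. Halving the strict inequality gives `l * q ≤ (m + r) + ψ * q`, and `m + r`
-- is the numerator used by `ceilDiv`.
length≤ceilDiv : ∀ r ψ m {l} → let q = suc r in
                 (q + q) * l < (m + m) + suc ψ * (q + q) → l ≤ ceilDiv m q + ψ
length≤ceilDiv r ψ m {l} lt = begin
  l                                 ≡⟨ m*n/n≡m l q ⟨
  (l * q) / q                       ≤⟨ /-monoˡ-≤ q (≤-pred half) ⟩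
  ((m + r) + ψ * q) / q             ≡⟨ +-distrib-/-∣ʳ (m + r) (n∣m*n ψ) ⟩
  (m + r) / q + (ψ * q) / q         ≡⟨ cong (λ t → (m + r) / q + t) (m*n/n≡m ψ q) ⟩
  (m + r) / q + ψ                   ∎
  where
  open ≤-Reasoning
  q = suc r
  leftSide : ∀ q l → (q + q) * l ≡ 2 * (l * q)
  leftSide = solve-∀
  rightSide : ∀ m ψ r → (m + m) + suc ψ * (suc r + suc r) ≡ 2 * suc ((m + r) + ψ * suc r)
  rightSide = solve-∀
  half : l * q < suc ((m + r) + ψ * q)
  half = *-cancelˡ-< 2 _ _ (subst₂ _<_ (leftSide q l) (rightSide m ψ r) lt)

-- Odd `p` is reduced to p - 1: the bound depends on the floor of p/2 alone, and sets of at most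
-- `p₀` vertices are admissible for `p`.
upperBound : ∀ p r ψ → ⌊ p /2⌋ ≡ suc r → let p₀ = suc r + suc r in p₀ ≤ p →
             (∀ {n} (L : Marking n) → Solved p₀ (total L + suc ψ * p₀) L) → BoundHolds p (+ ψ)
upperBound p r ψ half p₀≤p solve n G D₁ D₂ rewrite half =
  map tabulate (sets S) , solved⇒transforms G D₁ D₂ p₀≤p S ,
  ℤ.+≤+ (subst (_≤ ceilDiv (edgeCount G) (suc r) + ψ) (≡.sym (length-map tabulate (sets S)))
    (length≤ceilDiv r ψ (edgeCount G) (subst (λ t → p₀ * length (sets S) < t + suc ψ * p₀) (total-difference G D₁ D₂) (short S))))
  where
  p₀ = suc r + suc r
  S = solve (difference G D₁ D₂)

-- Lower bounds

-- On the graph without vertices the bound is `ψ` itself, and no length is negative.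
nonNegative : ∀ p → ceilDiv 0 ⌊ p /2⌋ ≡ 0 → ∀ ψ → BoundHolds p ψ → + 0 ℤ.≤ ψ
nonNegative p ceil≡0 ψ bound = from ψ (subst (λ c → + length (proj₁ sequence) ℤ.≤ + c ℤ.+ ψ) ceil≡0 (proj₂ (proj₂ sequence)))
  where
  empty : Graph 0
  empty = record { adj = λ () ; sym = λ () ; irrefl = λ () }
  trivial : Orientation empty
  trivial = record { arc = λ () ; oriented = λ () ; nonEdge = λ () }
  sequence = bound 0 empty trivial trivial
  from : ∀ ψ {l} → + l ℤ.≤ + 0 ℤ.+ ψ → + 0 ℤ.≤ ψ
  from (+ _)    _ = ℤ.+≤+ z≤n
  from -[1+ _ ] ()

triangle : Graph 3
triangle = record
  { adj    = λ i j → not (does (i ≟ j))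
  ; sym    = λ { 0F 0F → refl ; 0F 1F → refl ; 0F 2F → refl
               ; 1F 0F → refl ; 1F 1F → refl ; 1F 2F → refl
               ; 2F 0F → refl ; 2F 1F → refl ; 2F 2F → refl }
  ; irrefl = λ { 0F → refl ; 1F → refl ; 2F → refl }
  }

transitive : Orientation triangle
transitive = record
  { arc      = λ i j → does (toℕ i <? toℕ j)
  ; oriented = λ { 0F 0F () ; 0F 1F _ → refl ; 0F 2F _ → refl
                 ; 1F 0F _ → refl ; 1F 1F () ; 1F 2F _ → refl
                 ; 2F 0F _ → refl ; 2F 1F _ → refl ; 2F 2F () }
  ; nonEdge  = λ { 0F 0F _ → refl ; 0F 1F () ; 0F 2F ()
                 ; 1F 0F () ; 1F 1F _ → refl ; 1F 2F ()
                 ; 2F 0F () ; 2F 1F () ; 2F 2F _ → refl }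
  }

cyclic : Orientation triangle
cyclic = record
  { arc      = λ { 0F 2F → true ; 2F 1F → true ; 1F 0F → true ; _ _ → false }
  ; oriented = λ { 0F 0F () ; 0F 1F _ → refl ; 0F 2F _ → refl
                 ; 1F 0F _ → refl ; 1F 1F () ; 1F 2F _ → refl
                 ; 2F 0F _ → refl ; 2F 1F _ → refl ; 2F 2F () }
  ; nonEdge  = λ { 0F 0F _ → refl ; 0F 1F () ; 0F 2F ()
                 ; 1F 0F () ; 1F 1F _ → refl ; 1F 2F ()
                 ; 2F 0F () ; 2F 1F () ; 2F 2F _ → refl }
  }

-- The orientations differ on the edges 01 and 12 only. A single set reversing both contains all
-- three vertices and so reverses 02 as well.
transitive→cyclic : ∀ {p} Xs → Transforms p Xs (arc transitive) (arc cyclic) → 2 ≤ length Xs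
transitive→cyclic [] (_ , eq) = case eq 0F 1F of λ ()
transitive→cyclic ((false ∷ _ ∷ _ ∷ []) ∷ []) (_ , eq) = case eq 0F 1F of λ ()
transitive→cyclic ((true ∷ false ∷ _ ∷ []) ∷ []) (_ , eq) = case eq 0F 1F of λ ()
transitive→cyclic ((true ∷ true ∷ false ∷ []) ∷ []) (_ , eq) = case eq 1F 2F of λ ()
transitive→cyclic ((true ∷ true ∷ true ∷ []) ∷ []) (_ , eq) = case eq 0F 2F of λ ()
transitive→cyclic (_ ∷ _ ∷ _) _ = s≤s (s≤s z≤n)

-- For p at least 6 the three edges of the triangle contribute just 1 to the bound, while two
-- inversions are required.
atLeastOne : ∀ p → ceilDiv 3 ⌊ p /2⌋ ≡ 1 → ∀ ψ → BoundHolds p ψ → + 1 ℤ.≤ ψ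
atLeastOne p ceil≡1 ψ bound with bound 3 triangle transitive cyclic
... | Xs , tr , le = from ψ (transitive→cyclic Xs tr) (subst (λ c → + length Xs ℤ.≤ + c ℤ.+ ψ) ceil≡1 le)
  where
  from : ∀ ψ {l} → 2 ≤ l → + l ℤ.≤ + 1 ℤ.+ ψ → + 1 ℤ.≤ ψ
  from (+ zero)         2≤l (ℤ.+≤+ l≤1) = contradiction (≤-trans 2≤l l≤1) λ { (s≤s ()) }
  from (+ suc _)        _   _           = ℤ.+≤+ (s≤s z≤n)
  from -[1+ zero ]      2≤l (ℤ.+≤+ l≤0) = contradiction (≤-trans 2≤l l≤0) λ ()
  from -[1+ suc _ ]     _   ()

isPsi-0 : ∀ p r → r ≤ 1 → ⌊ p /2⌋ ≡ suc r → suc r + suc r ≤ p → ceilDiv 0 ⌊ p /2⌋ ≡ 0 → IsPsi p (+ 0)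
isPsi-0 p r r≤1 half p₀≤p ceil≡0 =
  upperBound p r 0 half p₀≤p (λ L → solved-mono (+-monoʳ-≤ (total L) (m≤m+n _ _)) (solved-≤5 r r≤1 L)) ,
  nonNegative p ceil≡0

theorem12 : ((p : ℕ) → 2 ≤ p → p ≤ 5 → IsPsi p (+ 0))
    × ((p : ℕ) → 6 ≤ p → p ≤ 9 → IsPsi p (+ 1))
theorem12 = small , large
  where
  small : (p : ℕ) → 2 ≤ p → p ≤ 5 → IsPsi p (+ 0)
  small 0 () _
  small 1 (s≤s ()) _
  small 2 _ _ = isPsi-0 2 0 z≤n refl ≤-refl refl
  small 3 _ _ = isPsi-0 3 0 z≤n refl (n≤1+n 2) refl
  small 4 _ _ = isPsi-0 4 1 ≤-refl refl ≤-refl refl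
  small 5 _ _ = isPsi-0 5 1 ≤-refl refl (n≤1+n 4) refl
  small (suc (suc (suc (suc (suc (suc p)))))) _ p≤5 = contradiction p≤5 (<⇒≱ (m≤m+n 6 p))
  large : (p : ℕ) → 6 ≤ p → p ≤ 9 → IsPsi p (+ 1)
  large 6 _ _ = upperBound 6 2 1 refl ≤-refl solved-6 , atLeastOne 6 refl
  large 7 _ _ = upperBound 7 2 1 refl (n≤1+n 6) solved-6 , atLeastOne 7 refl
  large 8 _ _ = upperBound 8 3 1 refl ≤-refl solved-8 , atLeastOne 8 refl
  large 9 _ _ = upperBound 9 3 1 refl (n≤1+n 8) solved-8 , atLeastOne 9 refl
  large 0 () _
  large 1 (s≤s ()) _
  large 2 (s≤s (s≤s ())) _
  large 3 (s≤s (s≤s (s≤s ()))) _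
  large 4 (s≤s (s≤s (s≤s (s≤s ())))) _
  large 5 (s≤s (s≤s (s≤s (s≤s (s≤s ()))))) _
  large (suc (suc (suc (suc (suc (suc (suc (suc (suc (suc p)))))))))) _ p≤9 = contradiction p≤9 (<⇒≱ (m≤m+n 10 p))
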